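{- For any integers $p,b\geq0$ the power series $\check M_p^{(b)}(\hat x_0,\hat x_1,\ldots)$ satisfies $D^{\mathrm{str}}\check M_p^{(b)}=0$ and $D^{\mathrm{dil}}\check M_p^{(b)}=-\check M_p^{(b)}$.
   Context: Define the formal power series in $r$ $$I(b,\ell;r)=\sum_{p=0}^\infty\frac{r^p}{(p!)^2}\prod_{m=0}^{p-1}(\ell^2-(b-m)^2),\qquad J(b;r)=\sum_{p=1}^\infty\frac{(-1)^{p+1}r^p}{p!(p-1)!}\prod_{m=0}^{p-2}(b-m)(b-m-1),$$ and $\check Z^{(b)}(r;\hat x_0,\hat x_1,\ldots)=J(b;r)-\sum_{\ell=0}^\infty I(b,\ell;r)\hat x_\ell$. $\check R^{(b)}(\hat x_0,\hat x_1,\ldots)$ is the unique formal power series with zero constant term satisfying $\check Z^{(b)}(\check R^{(b)};\hat x_0,\hat x_1,\ldots)=0$. For $p\geq0$ let $Q_p(b,j)$ be the unique polynomial with $$\sum_{k=b}^{j-1}\binom{2k+1+p}{2p+1}\binom{2j-1}{j+k}=\binom{2j-1}{j+b}Q_p(b,j)\quad\text{for all integers }j>b\geq0,$$ and define $$\check M_p^{(b)}(\hat x_0,\hat x_1,\ldots)=Q_p(b,(1+r)\,\partial_r)\,(1+r)^{ -b}\,\check Z^{(b)}(r;\hat x_0,\hat x_1,\ldots)\Big|_{r=\check R^{(b)}(\hat x_0,\hat x_1,\ldots)},$$ where $j$ in $Q_p(b,j)$ is replaced by the operator $(1+r)\partial_r$ acting on $(1+r)^{ -b}\check Z^{(b)}$.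 The operators are $$D^{\mathrm{str}}=\frac{\partial}{\partial\hat x_1}-\sum_{\ell=0}^\infty\hat x_\ell\left(-\ell\frac{\partial}{\partial\hat x_\ell}+\sum_{k=1}^\ell2k\frac{\partial}{\partial\hat x_k}-\sum_{k=1}^b2k\frac{\partial}{\partial\hat x_k}\right),\qquad D^{\mathrm{dil}}=\frac{\partial}{\partial\hat x_1}-\frac{\partial}{\partial\hat x_0}-\sum_{\ell=0}^\infty\hat x_\ell\frac{\partial}{\partial\hat x_\ell}.$$ -}

module Defs where

open import Data.Nat as ℕ using (ℕ; zero; suc; _!; _∸_; _<_)
open import Data.Nat.Combinatorics using (_C_)
import Data.Nat.Properties as ℕₚ
open import Data.Integer as ℤ using (ℤ; +_; -1ℤ)
import Data.Integer.Properties as ℤₚ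
open import Data.Rational using (ℚ; 0ℚ; _+_; _*_; -_; _-_; _/_)
import Data.Rational.Properties as ℚₚ
open import Data.Fin using (Fin; toℕ; inject₁; fromℕ)
open import Data.Fin.Properties using (toℕ-inject₁; toℕ-fromℕ)
open import Data.List using (List; []; _∷_; _++_; [_]; length; map)
open import Data.List.Properties using (length-++)
open import Data.Nat.ListAction using () renaming (sum to degree)
open import Data.Nat.ListAction.Properties using () renaming (sum-++ to degree-++)
open import Data.Maybe using (Maybe; just; nothing; maybe′) renaming (map to mapᴹ)
open import Data.Product using (_×_)
open import Function using (_∘_)
open import Relation.Binary.PropositionalEquality using (_≡_; refl; sym; trans; cong; cong₂; module ≡-Reasoning)

open import Algebra.Properties.Monoid.Sum ℚₚ.+-0-monoid using (sum; sum-syntax; sum⁺-syntax; sum-cong-≗; sum-init-last)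
open import Algebra.Properties.Monoid.Sum ℤₚ.*-1-monoid using () renaming (sum to productℤ)

product-syntax : ∀ n → (Fin n → ℤ) → ℤ
product-syntax _ = productℤ

infixl 10 product-syntax
syntax product-syntax n (λ m → x) = ∏[ m < n ] x

infix  4 _≈_
infixl 6 _⊕_ _⊖_
infixl 7 _⊗_ _·_
infixr 8 _↑_
infix  8 x_·_

fromℕℚ : ℕ → ℚ
fromℕℚ n = + n / 1

------------------------------------------------------------------------
-- Formal power series over ℚ in the variables x̂₀, x̂₁, x̂₂, …

-- The list a₀ ∷ a₁ ∷ … ∷ aₙ ∷ [] stands for the monomial
-- x̂₀^a₀ x̂₁^a₁ ⋯ x̂ₙ^aₙ.  Lists differing by trailing zeros denote the same
-- monomial, which is what coeff-pad accounts for.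
Monomial : Set
Monomial = List ℕ

record PowerSeries : Set where
  field
    coeff     : Monomial → ℚ
    coeff-pad : ∀ α → coeff (α ++ [ 0 ]) ≡ coeff α

open PowerSeries public

_≈_ : PowerSeries → PowerSeries → Set
f ≈ g = ∀ α → coeff f α ≡ coeff g α

const : ℚ → PowerSeries
const q = record { coeff = c ; coeff-pad = pad }
  where
  c : Monomial → ℚ
  c []          = q
  c (zero  ∷ α) = c α
  c (suc _ ∷ α) = 0ℚ

  pad : ∀ α → c (α ++ [ 0 ]) ≡ c α
  pad []          = refl
  pad (zero  ∷ α) = pad α
  pad (suc _ ∷ α) = refl

_⊕_ : PowerSeries → PowerSeries → PowerSeries
f ⊕ g = record
  { coeff     = λ α → coeff f α + coeff g α
  ; coeff-pad = λ α → cong₂ _+_ (coeff-pad f α) (coeff-pad g α)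
  }

_·_ : ℚ → PowerSeries → PowerSeries
q · f = record
  { coeff     = λ α → q * coeff f α
  ; coeff-pad = λ α → cong (q *_) (coeff-pad f α)
  }

neg : PowerSeries → PowerSeries
neg f = record
  { coeff     = λ α → - coeff f α
  ; coeff-pad = λ α → cong -_ (coeff-pad f α)
  }

_⊖_ : PowerSeries → PowerSeries → PowerSeries
f ⊖ g = f ⊕ neg g

-- sumPS n G = G 0 + G 1 + ⋯ + G (n - 1)
sumPS : ℕ → (ℕ → PowerSeries) → PowerSeries
sumPS n G = record
  { coeff     = λ α → ∑[ i < n ] coeff (G (toℕ i)) α
  ; coeff-pad = λ α → sum-cong-≗ {n} (λ i → coeff-pad (G (toℕ i)) α)
  }

-- The Cauchy product, one variable at a time: i ∷_ picks out the coefficient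
-- of x̂₀^i, a power series in the remaining variables.
cauchy : (Monomial → ℚ) → (Monomial → ℚ) → Monomial → ℚ
cauchy f g []      = f [] * g []
cauchy f g (a ∷ α) = ∑[ i ≤ a ] cauchy (f ∘ (toℕ i ∷_)) (g ∘ ((a ∸ toℕ i) ∷_)) α

cauchy-pad : ∀ {f g} →
             (∀ α → f (α ++ [ 0 ]) ≡ f α) → (∀ α → g (α ++ [ 0 ]) ≡ g α) →
             ∀ α → cauchy f g (α ++ [ 0 ]) ≡ cauchy f g α
cauchy-pad p q []      = trans (ℚₚ.+-identityʳ _) (cong₂ _*_ (p []) (q []))
cauchy-pad p q (a ∷ α) = sum-cong-≗ {suc a} λ i →
  cauchy-pad (p ∘ (toℕ i ∷_)) (q ∘ ((a ∸ toℕ i) ∷_)) α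

_⊗_ : PowerSeries → PowerSeries → PowerSeries
f ⊗ g = record
  { coeff     = cauchy (coeff f) (coeff g)
  ; coeff-pad = cauchy-pad (coeff-pad f) (coeff-pad g)
  }

_↑_ : PowerSeries → ℕ → PowerSeries
f ↑ zero  = const (fromℕℚ 1)
f ↑ suc n = f ⊗ (f ↑ n)

------------------------------------------------------------------------
-- Partial derivatives and infinite sums ∑_ℓ x̂_ℓ G_ℓ

exponent : ℕ → Monomial → ℕ
exponent k       []      = 0
exponent zero    (a ∷ α) = a
exponent (suc k) (a ∷ α) = exponent k α

-- raise k α is x̂ₖ · α
raise : ℕ → Monomial → Monomial
raise zero    []      = 1 ∷ []
raise zero    (a ∷ α) = suc a ∷ α
raise (suc k) []      = 0 ∷ raise k []
raise (suc k) (a ∷ α) = a ∷ raise k α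

-- lower k α is α / x̂ₖ, if x̂ₖ divides α
lower : ℕ → Monomial → Maybe Monomial
lower k       []          = nothing
lower zero    (zero  ∷ α) = nothing
lower zero    (suc a ∷ α) = just (a ∷ α)
lower (suc k) (a ∷ α)     = mapᴹ (a ∷_) (lower k α)

exponent-pad : ∀ k α → exponent k (α ++ [ 0 ]) ≡ exponent k α
exponent-pad zero    []      = refl
exponent-pad (suc k) []      = refl
exponent-pad zero    (a ∷ α) = refl
exponent-pad (suc k) (a ∷ α) = exponent-pad k α

raise-pad : ∀ (f : Monomial → ℚ) → (∀ α → f (α ++ [ 0 ]) ≡ f α) →
            ∀ k α → f (raise k (α ++ [ 0 ])) ≡ f (raise k α)
raise-pad f p zero    []      = refl
raise-pad f p (suc k) []      = refl
raise-pad f p zero    (a ∷ α) = p (suc a ∷ α)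
raise-pad f p (suc k) (a ∷ α) = raise-pad (f ∘ (a ∷_)) (p ∘ (a ∷_)) k α

lower-pad : ∀ (f : Monomial → ℚ) → (∀ α → f (α ++ [ 0 ]) ≡ f α) →
            ∀ k α → maybe′ f 0ℚ (lower k (α ++ [ 0 ])) ≡ maybe′ f 0ℚ (lower k α)
lower-pad f p zero    []          = refl
lower-pad f p (suc k) []          = refl
lower-pad f p zero    (zero  ∷ α) = refl
lower-pad f p zero    (suc a ∷ α) = p (a ∷ α)
lower-pad f p (suc k) (a ∷ α)     =
  trans (fuse (lower k (α ++ [ 0 ])))
    (trans (lower-pad (f ∘ (a ∷_)) (p ∘ (a ∷_)) k α) (sym (fuse (lower k α))))
  where
  fuse : ∀ m → maybe′ f 0ℚ (mapᴹ (a ∷_) m) ≡ maybe′ (f ∘ (a ∷_)) 0ℚ m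
  fuse (just _) = refl
  fuse nothing  = refl

lower-length : ∀ α → lower (length α) (α ++ [ 0 ]) ≡ nothing
lower-length []      = refl
lower-length (a ∷ α) = cong (mapᴹ (a ∷_)) (lower-length α)

∂ : ℕ → PowerSeries → PowerSeries
∂ k f = record
  { coeff     = λ α → fromℕℚ (suc (exponent k α)) * coeff f (raise k α)
  ; coeff-pad = λ α → cong₂ (λ n q → fromℕℚ (suc n) * q)
                        (exponent-pad k α) (raise-pad (coeff f) (coeff-pad f) k α)
  }

x_·_ : ℕ → PowerSeries → PowerSeries
x ℓ · f = record
  { coeff     = maybe′ (coeff f) 0ℚ ∘ lower ℓ
  ; coeff-pad = lower-pad (coeff f) (coeff-pad f) ℓ
  }

-- ∑x G = ∑_{ℓ ≥ 0} x̂_ℓ G_ℓ.  Only the ℓ with x̂_ℓ dividing α contribute to the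
-- coefficient of α, and these satisfy ℓ < length α.
∑x : (ℕ → PowerSeries) → PowerSeries
∑x G = record { coeff = c ; coeff-pad = pad }
  where
  c : Monomial → ℚ
  c α = ∑[ ℓ < length α ] coeff (x toℕ ℓ · G (toℕ ℓ)) α

  pad : ∀ α → c (α ++ [ 0 ]) ≡ c α
  pad α = begin
    c (α ++ [ 0 ])
      ≡⟨ cong (λ n → ∑[ ℓ < n ] t (toℕ ℓ)) (trans (length-++ α) (ℕₚ.+-comm _ 1)) ⟩
    ∑[ ℓ ≤ length α ] t (toℕ ℓ)
      ≡⟨ sum-init-last {length α} (t ∘ toℕ) ⟩
    ∑[ ℓ < length α ] t (toℕ (inject₁ ℓ)) + t (toℕ (fromℕ (length α)))
      ≡⟨ cong₂ _+_ (sum-cong-≗ {length α} step) last≡0 ⟩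
    c α + 0ℚ
      ≡⟨ ℚₚ.+-identityʳ (c α) ⟩
    c α ∎
    where
    open ≡-Reasoning
    t : ℕ → ℚ
    t ℓ = coeff (x ℓ · G ℓ) (α ++ [ 0 ])

    step : ∀ ℓ → t (toℕ (inject₁ ℓ)) ≡ coeff (x toℕ ℓ · G (toℕ ℓ)) α
    step ℓ = trans (cong t (toℕ-inject₁ ℓ)) (coeff-pad (x toℕ ℓ · G (toℕ ℓ)) α)

    last≡0 : t (toℕ (fromℕ (length α))) ≡ 0ℚ
    last≡0 = trans (cong t (toℕ-fromℕ (length α)))
                   (cong (maybe′ (coeff (G (length α))) 0ℚ) (lower-length α))

------------------------------------------------------------------------
-- Formal power series in r whose coefficients are power series in x̂

-- F n is the coefficient of r^n
Series : Set
Series = ℕ → PowerSeries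

∂r : Series → Series
∂r F n = fromℕℚ (suc n) · F (suc n)

[1+r]·_ : Series → Series
([1+r]· F) zero    = F zero
([1+r]· F) (suc n) = F (suc n) ⊕ F n

θ : Series → Series
θ F = [1+r]· ∂r F

[1+r]⁻¹·_ : Series → Series
([1+r]⁻¹· F) zero    = F zero
([1+r]⁻¹· F) (suc n) = F (suc n) ⊖ ([1+r]⁻¹· F) n

[1+r]-inverse : ∀ F n → ([1+r]· ([1+r]⁻¹· F)) n ≈ F n
[1+r]-inverse F zero    α = refl
[1+r]-inverse F (suc n) α = begin
  (u - v) + v  ≡⟨ ℚₚ.+-assoc u (- v) v ⟩
  u + (- v + v) ≡⟨ cong (_+_ u) (ℚₚ.+-inverseˡ v) ⟩
  u + 0ℚ       ≡⟨ ℚₚ.+-identityʳ u ⟩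
  u            ∎
  where
  open ≡-Reasoning
  u = coeff (F (suc n)) α
  v = coeff (([1+r]⁻¹· F) n) α

[1+r]^-_·_ : ℕ → Series → Series
[1+r]^- zero  · F = F
[1+r]^- suc b · F = [1+r]⁻¹· ([1+r]^- b · F)

-- Substitution r = R, i.e. ∑_n F_n R^n.  Meaningful only if R has zero constant
-- term: then R^n has no monomials of degree below n, so that the coefficient of α
-- receives contributions from n ≤ degree α only.
_∣r=_ : Series → PowerSeries → PowerSeries
F ∣r= R = record
  { coeff     = λ α → c (degree α) α
  ; coeff-pad = λ α → trans
      (cong (λ d → c d (α ++ [ 0 ])) (trans (degree-++ α [ 0 ]) (ℕₚ.+-identityʳ _)))
      (sum-cong-≗ {suc (degree α)} λ n → coeff-pad (F (toℕ n) ⊗ R ↑ toℕ n) α)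
  }
  where
  c : ℕ → Monomial → ℚ
  c d α = ∑[ n ≤ d ] coeff (F (toℕ n) ⊗ R ↑ toℕ n) α

------------------------------------------------------------------------
-- I(b,ℓ;r), J(b;r), Ž⁽ᵇ⁾ and Ř⁽ᵇ⁾

-- coefficient of r^p in I(b,ℓ;r)
I : (b ℓ p : ℕ) → ℚ
I b ℓ p = (∏[ m < p ] ((+ ℓ) ℤ.^ 2 ℤ.- (+ b ℤ.- + toℕ m) ℤ.^ 2)) / (p ! ℕ.* p !)
  where instance _ = p ℕₚ.!* p !≢0

-- coefficient of r^p in J(b;r)
J : (b p : ℕ) → ℚ
J b zero        = 0ℚ
J b p@(suc p-1) =
  (-1ℤ ℤ.^ (p ℕ.+ 1) ℤ.* ∏[ m < p-1 ] ((+ b ℤ.- + toℕ m) ℤ.* (+ b ℤ.- + toℕ m ℤ.- + 1)))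
    / (p ! ℕ.* p-1 !)
  where instance _ = p ℕₚ.!* p-1 !≢0

Ž : ℕ → Series
Ž b p = const (J b p) ⊖ ∑x (λ ℓ → const (I b ℓ p))

IsŘ : ℕ → PowerSeries → Set
IsŘ b R = coeff R [] ≡ 0ℚ × (Ž b ∣r= R) ≈ const 0ℚ

------------------------------------------------------------------------
-- The polynomials Qₚ(b,j) and the series M̌ₚ⁽ᵇ⁾

-- c₀ ∷ c₁ ∷ c₂ ∷ … stands for c₀ + c₁ t + c₂ t² + ⋯
Poly : Set
Poly = List ℚ

eval : Poly → ℚ → ℚ
eval []      t = 0ℚ
eval (c ∷ P) t = c + t * eval P t

-- Polynomials in b and j, as polynomials in j with coefficients in ℚ[b]
Poly₂ : Set
Poly₂ = List Poly

specialise : Poly₂ → ℕ → Poly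
specialise Q b = map (λ c → eval c (fromℕℚ b)) Q

eval₂ : Poly₂ → ℕ → ℕ → ℚ
eval₂ Q b j = eval (specialise Q b) (fromℕℚ j)

-- The summation index is k = b + i.
IsQ : ℕ → Poly₂ → Set
IsQ p Q = ∀ (b j : ℕ) → b < j →
  ∑[ i < j ∸ b ] (let k = b ℕ.+ toℕ i in
     fromℕℚ (((2 ℕ.* k ℕ.+ 1 ℕ.+ p) C (2 ℕ.* p ℕ.+ 1)) ℕ.* ((2 ℕ.* j ∸ 1) C (j ℕ.+ k))))
  ≡ fromℕℚ ((2 ℕ.* j ∸ 1) C (j ℕ.+ b)) * eval₂ Q b j

-- applyθ P F = P(θ) F
applyθ : Poly → Series → Series
applyθ []      F n = const 0ℚ
applyθ (c ∷ P) F n = c · F n ⊕ θ (applyθ P F) n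

-- M̌ₚ⁽ᵇ⁾, given Q = Qₚ and R = Ř⁽ᵇ⁾
M̌ : Poly₂ → ℕ → PowerSeries → PowerSeries
M̌ Q b R = applyθ (specialise Q b) ([1+r]^- b · Ž b) ∣r= R

------------------------------------------------------------------------
-- The operators D^str and D^dil

-- ∑_{k=1}^n 2k ∂/∂x̂ₖ
∑2k∂ : ℕ → PowerSeries → PowerSeries
∑2k∂ n f = sumPS n (λ i → fromℕℚ (2 ℕ.* suc i) · ∂ (suc i) f)

Dˢᵗʳ : ℕ → PowerSeries → PowerSeries
Dˢᵗʳ b f = ∂ 1 f ⊖ ∑x (λ ℓ → neg (fromℕℚ ℓ · ∂ ℓ f) ⊕ ∑2k∂ ℓ f ⊖ ∑2k∂ b f)

Dᵈⁱˡ : PowerSeries → PowerSeries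
Dᵈⁱˡ f = ∂ 1 f ⊖ ∂ 0 f ⊖ ∑x (λ ℓ → ∂ ℓ f)

{-# OPTIONS --safe #-}

-- Put W = (1+r)^{-b} Ž.  Both operators D are derivations which act on the
-- coefficients of W as D W = s θ W + u W with θ = (1+r)∂_r, where (s,u) = (-1,0) for
-- D^str and (s,u) = (0,-1) for D^dil.  This comes down to the identities
--   J = I(1) - I(0),   (θ - b) J = I(1),
--   (θ - b) I(ℓ) = -ℓ I(ℓ) + ∑_{k=1}^ℓ 2k I(k) - ∑_{k=1}^b 2k I(k).
-- D commutes with θ, so it acts in the same way on F = P(θ) W for every polynomial P,
-- and the chain rule gives D(F(R)) = F′(R) (s(1+R) + D R) + u F(R).  For F = W the left
-- hand side and W(R) vanish while W′(R) is invertible, hence s(1+R) + D R = 0.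
module Submission where

open import Defs
open import Data.Nat as ℕ using (ℕ; zero; suc; _!; _∸_; _≤_; _<_; z≤n; s≤s)
import Data.Nat.Properties as ℕₚ
open import Data.Integer as ℤ using (ℤ; +_; -1ℤ)
import Data.Integer.Properties as ℤₚ
import Data.Integer.Solver as ℤSolver
open import Data.Fin using (toℕ)
open import Data.Fin.Properties using (toℕ-inject₁; toℕ-fromℕ)
open import Data.List using ([]; _∷_; _++_; [_]; length)
open import Data.Maybe using (just; nothing; maybe′) renaming (map to mapᴹ)
open import Data.Nat.ListAction using () renaming (sum to degree)
open import Data.Product using (_×_; _,_)
open import Data.Rational using (ℚ; 0ℚ; 1ℚ; _+_; _*_; -_; _-_; _/_; toℚᵘ; 1/_; ≢-nonZero)
import Data.Rational.Properties as ℚₚ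
open import Data.Rational.Solver using (module +-*-Solver)
import Data.Rational.Unnormalised as ℚᵘ
import Data.Rational.Unnormalised.Properties as ℚᵘₚ
open import Function using (_∘_; flip)
open import Level using (0ℓ)
open import Relation.Binary.Bundles using (Setoid)
open import Relation.Binary.PropositionalEquality using (_≡_; _≢_; refl; sym; trans; cong; cong₂; subst; module ≡-Reasoning)
import Relation.Binary.Reasoning.Setoid as SetoidReasoning
open import Algebra.Properties.Monoid.Sum ℚₚ.+-0-monoid using (sum-syntax; sum⁺-syntax; sum-cong-≗; sum-init-last)
open import Algebra.Properties.Monoid.Sum ℤₚ.*-1-monoid using () renaming (sum-init-last to product-init-last; sum-cong-≗ to product-cong-≗)

open +-*-Solver

-- Rational numbers and the coefficients of I and J

-- On `Ž` itself the pair (s,u) for D^str is (-1,b), because the identities for I and J involve θ -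
-- b. As θ (1+r)^(-b) = (1+r)^(-b) (θ - b), the prefactor moves u by b s: to 0 for D^str, and not at
-- all for D^dil, where s = 0. Substitution for r and the sums over ℓ are infinite and accessible
-- only coefficient by coefficient. Agreement below a given degree therefore serves as the topology,
-- and a derivation is required to lose at most one degree; rules such as the chain rule can then be
-- checked on finite partial sums. The quotient of consecutive I(ℓ) may have a zero denominator at ℓ
-- = b, so it is used in cross-multiplied form. The same point ℓ = b fixes the constant in the
-- summation over ℓ, since I(b,b;r) = 1.

ι : ℤ → ℚ
ι i = i / 1

toℚᵘ-ι : ∀ i → toℚᵘ (ι i) ℚᵘ.≃ ℚᵘ.mkℚᵘ i 0
toℚᵘ-ι i = ℚₚ.toℚᵘ-fromℚᵘ (ℚᵘ.mkℚᵘ i 0)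

ι-+ : ∀ i j → ι (i ℤ.+ j) ≡ ι i + ι j
ι-+ i j = ℚₚ.toℚᵘ-injective (ℚᵘₚ.≃-trans (toℚᵘ-ι (i ℤ.+ j)) (ℚᵘₚ.≃-sym
  (ℚᵘₚ.≃-trans (ℚₚ.toℚᵘ-homo-+ (ι i) (ι j))
  (ℚᵘₚ.≃-trans (ℚᵘₚ.+-cong (toℚᵘ-ι i) (toℚᵘ-ι j))
  (ℚᵘ.*≡* (cong (ℤ._* + 1) (cong₂ ℤ._+_ (ℤₚ.*-identityʳ i) (ℤₚ.*-identityʳ j))))))))

ι-* : ∀ i j → ι (i ℤ.* j) ≡ ι i * ι j
ι-* i j = ℚₚ.toℚᵘ-injective (ℚᵘₚ.≃-trans (toℚᵘ-ι (i ℤ.* j)) (ℚᵘₚ.≃-sym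
  (ℚᵘₚ.≃-trans (ℚₚ.toℚᵘ-homo-* (ι i) (ι j))
  (ℚᵘₚ.*-cong (toℚᵘ-ι i) (toℚᵘ-ι j)))))

ι-neg : ∀ i → ι (ℤ.- i) ≡ - ι i
ι-neg i = ℚₚ.toℚᵘ-injective (ℚᵘₚ.≃-trans (toℚᵘ-ι (ℤ.- i)) (ℚᵘₚ.≃-sym
  (ℚᵘₚ.≃-trans (ℚₚ.toℚᵘ-homo‿- (ι i)) (ℚᵘₚ.-‿cong (toℚᵘ-ι i)))))

ι-injective : ∀ {i j} → ι i ≡ ι j → i ≡ j
ι-injective {i} {j} eq with ℚᵘₚ.≃-trans (ℚᵘₚ.≃-sym (toℚᵘ-ι i)) (ℚᵘₚ.≃-trans (ℚₚ.toℚᵘ-cong eq) (toℚᵘ-ι j))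
... | ℚᵘ.*≡* e = trans (sym (ℤₚ.*-identityʳ i)) (trans e (ℤₚ.*-identityʳ j))

ι-- : ∀ i j → ι (i ℤ.- j) ≡ ι i - ι j
ι-- i j = trans (ι-+ i (ℤ.- j)) (cong (_+_ (ι i)) (ι-neg j))

-- Clearing denominators: the recurrences for I and J come from comparing integer products after
-- this step.
/-* : ∀ i d .{{_ : ℕ.NonZero d}} → fromℕℚ d * (i / d) ≡ ι i
/-* i d@(suc d-1) = ℚₚ.toℚᵘ-injective (ℚᵘₚ.≃-trans
  (ℚₚ.toℚᵘ-homo-* (fromℕℚ d) (i / d))
  (ℚᵘₚ.≃-trans (ℚᵘₚ.*-cong (toℚᵘ-ι (+ d)) (ℚₚ.toℚᵘ-fromℚᵘ (ℚᵘ.mkℚᵘ i d-1)))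
  (ℚᵘₚ.≃-trans (ℚᵘ.*≡* eq) (ℚᵘₚ.≃-sym (toℚᵘ-ι i)))))
  where
  eq : (+ d ℤ.* i) ℤ.* + 1 ≡ i ℤ.* + (1 ℕ.* d)
  eq = trans (ℤₚ.*-identityʳ _) (trans (ℤₚ.*-comm (+ d) i) (cong (λ n → i ℤ.* + n) (sym (ℕₚ.*-identityˡ d))))

fromℕℚ-+ : ∀ m n → fromℕℚ (m ℕ.+ n) ≡ fromℕℚ m + fromℕℚ n
fromℕℚ-+ m n = ι-+ (+ m) (+ n)

fromℕℚ-* : ∀ m n → fromℕℚ (m ℕ.* n) ≡ fromℕℚ m * fromℕℚ n
fromℕℚ-* m n = trans (cong ι (ℤₚ.pos-* m n)) (ι-* (+ m) (+ n))

fromℕℚ-suc : ∀ n → fromℕℚ (suc n) ≡ 1ℚ + fromℕℚ n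
fromℕℚ-suc n = fromℕℚ-+ 1 n

fromℕℚ-≢0 : ∀ n .{{_ : ℕ.NonZero n}} → fromℕℚ n ≢ 0ℚ
fromℕℚ-≢0 (suc n) eq with ι-injective {+ suc n} {+ 0} eq
... | ()

*-cancelˡ : ∀ {q x y} → q ≢ 0ℚ → q * x ≡ q * y → x ≡ y
*-cancelˡ {q} {x} {y} q≢0 eq = begin
  x                  ≡⟨ ℚₚ.*-identityˡ x ⟨
  1ℚ * x             ≡⟨ cong (_* x) (ℚₚ.*-inverseˡ q) ⟨
  (q⁻¹ * q) * x      ≡⟨ ℚₚ.*-assoc q⁻¹ q x ⟩
  q⁻¹ * (q * x)      ≡⟨ cong (q⁻¹ *_) eq ⟩
  q⁻¹ * (q * y)      ≡⟨ ℚₚ.*-assoc q⁻¹ q y ⟨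
  (q⁻¹ * q) * y      ≡⟨ cong (_* y) (ℚₚ.*-inverseˡ q) ⟩
  1ℚ * y             ≡⟨ ℚₚ.*-identityˡ y ⟩
  y                  ∎
  where
  open ≡-Reasoning
  instance _ = ≢-nonZero q≢0
  q⁻¹ = 1/ q

*-cancelˡ-suc : ∀ n {x y} → fromℕℚ (suc n) * x ≡ fromℕℚ (suc n) * y → x ≡ y
*-cancelˡ-suc n = *-cancelˡ (fromℕℚ-≢0 (suc n))

-- Recurrences for the coefficients of I and J

product-last : ∀ p (f : ℕ → ℤ) → ∏[ m < suc p ] f (toℕ m) ≡ ∏[ m < p ] f (toℕ m) ℤ.* f p
product-last p f = trans (product-init-last {p} (f ∘ toℕ))
  (cong₂ ℤ._*_ (product-cong-≗ {p} (cong f ∘ toℕ-inject₁)) (cong f (toℕ-fromℕ p)))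

-- The new factor is split as a difference of squares because all later cancellations take place
-- between the linear factors.
I-suc : ∀ b ℓ p → fromℕℚ (suc p) * (fromℕℚ (suc p) * I b ℓ (suc p)) ≡
        I b ℓ p * ((fromℕℚ ℓ - (fromℕℚ b - fromℕℚ p)) * (fromℕℚ ℓ + (fromℕℚ b - fromℕℚ p)))
I-suc b ℓ p = *-cancelˡ (fromℕℚ-≢0 (p ! ℕ.* p !)) (begin
  d * (s * (s * i′))        ≡⟨ solve 3 (λ d s i → d :* (s :* (s :* i)) := (s :* s :* d) :* i) refl d s i′ ⟩
  (s * s * d) * i′          ≡⟨ cong (_* i′) dd ⟨
  fromℕℚ (suc p ! ℕ.* suc p !) * i′ ≡⟨ /-* (∏[ m < suc p ] f (toℕ m)) (suc p ! ℕ.* suc p !) ⟩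
  ι (∏[ m < suc p ] f (toℕ m))      ≡⟨ cong ι (product-last p f) ⟩
  ι (a ℤ.* f p)             ≡⟨ ι-* a (f p) ⟩
  ι a * ι (f p)             ≡⟨ cong₂ _*_ (sym (/-* a (p ! ℕ.* p !))) ιf ⟩
  (d * I b ℓ p) * v         ≡⟨ ℚₚ.*-assoc d (I b ℓ p) v ⟩
  d * (I b ℓ p * v)         ∎)
  where
  open ≡-Reasoning
  instance
    nz : ℕ.NonZero (p ! ℕ.* p !)
    nz = p ℕₚ.!* p !≢0
    nz′ : ℕ.NonZero (suc p ! ℕ.* suc p !)
    nz′ = suc p ℕₚ.!* suc p !≢0
  f : ℕ → ℤ
  f m = (+ ℓ) ℤ.^ 2 ℤ.- (+ b ℤ.- + m) ℤ.^ 2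
  a = ∏[ m < p ] f (toℕ m)
  d = fromℕℚ (p ! ℕ.* p !)
  s = fromℕℚ (suc p)
  i′ = I b ℓ (suc p)
  v = (fromℕℚ ℓ - (fromℕℚ b - fromℕℚ p)) * (fromℕℚ ℓ + (fromℕℚ b - fromℕℚ p))
  dd : fromℕℚ (suc p ! ℕ.* suc p !) ≡ s * s * d
  dd = begin
    fromℕℚ (suc p ! ℕ.* suc p !) ≡⟨ fromℕℚ-* (suc p !) (suc p !) ⟩
    fromℕℚ (suc p !) * fromℕℚ (suc p !) ≡⟨ cong₂ _*_ (fromℕℚ-* (suc p) (p !)) (fromℕℚ-* (suc p) (p !)) ⟩
    (s * e) * (s * e) ≡⟨ solve 2 (λ s e → (s :* e) :* (s :* e) := s :* s :* (e :* e)) refl s e ⟩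
    s * s * (e * e) ≡⟨ cong (s * s *_) (fromℕℚ-* (p !) (p !)) ⟨
    s * s * d ∎
    where e = fromℕℚ (p !)
  factor : f p ≡ (+ ℓ ℤ.- (+ b ℤ.- + p)) ℤ.* (+ ℓ ℤ.+ (+ b ℤ.- + p))
  factor = ℤSolver.+-*-Solver.solve 2 (λ x y → x :^′ 2 :-′ y :^′ 2 :=′ (x :-′ y) :*′ (x :+′ y)) refl (+ ℓ) (+ b ℤ.- + p)
    where open ℤSolver.+-*-Solver using () renaming (_:^_ to _:^′_; _:-_ to _:-′_; _:=_ to _:=′_; _:*_ to _:*′_; _:+_ to _:+′_)
  ιf : ι (f p) ≡ v
  ιf = trans (cong ι factor) (trans (ι-* (+ ℓ ℤ.- (+ b ℤ.- + p)) (+ ℓ ℤ.+ (+ b ℤ.- + p)))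
         (cong₂ _*_ (trans (ι-- (+ ℓ) (+ b ℤ.- + p)) (cong (_-_ (fromℕℚ ℓ)) (ι-- (+ b) (+ p))))
                    (trans (ι-+ (+ ℓ) (+ b ℤ.- + p)) (cong (_+_ (fromℕℚ ℓ)) (ι-- (+ b) (+ p))))))

-- The recurrence starts at r^1: the coefficient of r^0 is 0 and does not determine the next one.
-- The minus sign comes from the alternating sign of J.
J-suc : ∀ b p → fromℕℚ (suc (suc p)) * (fromℕℚ (suc p) * J b (suc (suc p))) ≡
        - (J b (suc p) * ((fromℕℚ b - fromℕℚ p) * (fromℕℚ b - fromℕℚ p - 1ℚ)))
J-suc b p = *-cancelˡ (fromℕℚ-≢0 (suc p ! ℕ.* p !)) (begin
  d * (s′ * (s * j′))       ≡⟨ solve 4 (λ d s′ s j → d :* (s′ :* (s :* j)) := (s′ :* s :* d) :* j) refl d s′ s j′ ⟩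
  (s′ * s * d) * j′         ≡⟨ cong (_* j′) dd ⟨
  fromℕℚ (suc (suc p) ! ℕ.* suc p !) * j′
    ≡⟨ /-* (sg (suc (suc p)) ℤ.* ∏[ m < suc p ] f (toℕ m)) (suc (suc p) ! ℕ.* suc p !) ⟩
  ι (sg (suc (suc p)) ℤ.* ∏[ m < suc p ] f (toℕ m)) ≡⟨ cong (λ z → ι (sg (suc (suc p)) ℤ.* z)) (product-last p f) ⟩
  ι (sg (suc (suc p)) ℤ.* (a ℤ.* f p)) ≡⟨ cong ι (shuffle (sg (suc p)) a (f p)) ⟩
  ι (ℤ.- (sg (suc p) ℤ.* a ℤ.* f p)) ≡⟨ ι-neg (sg (suc p) ℤ.* a ℤ.* f p) ⟩
  - ι (sg (suc p) ℤ.* a ℤ.* f p) ≡⟨ cong -_ (ι-* (sg (suc p) ℤ.* a) (f p)) ⟩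
  - (ι (sg (suc p) ℤ.* a) * ι (f p))
    ≡⟨ cong -_ (cong₂ _*_ (sym (/-* (sg (suc p) ℤ.* a) (suc p ! ℕ.* p !))) ιf) ⟩
  - ((d * J b (suc p)) * v) ≡⟨ solve 3 (λ d j v → :- ((d :* j) :* v) := d :* (:- (j :* v))) refl d (J b (suc p)) v ⟩
  d * - (J b (suc p) * v)   ∎)
  where
  open ≡-Reasoning
  instance
    nz : ℕ.NonZero (suc p ! ℕ.* p !)
    nz = suc p ℕₚ.!* p !≢0
    nz′ : ℕ.NonZero (suc (suc p) ! ℕ.* suc p !)
    nz′ = suc (suc p) ℕₚ.!* suc p !≢0
  f : ℕ → ℤ
  f m = (+ b ℤ.- + m) ℤ.* (+ b ℤ.- + m ℤ.- + 1)
  sg : ℕ → ℤ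
  sg n = -1ℤ ℤ.^ (n ℕ.+ 1)
  a = ∏[ m < p ] f (toℕ m)
  d = fromℕℚ (suc p ! ℕ.* p !)
  s = fromℕℚ (suc p)
  s′ = fromℕℚ (suc (suc p))
  j′ = J b (suc (suc p))
  v = (fromℕℚ b - fromℕℚ p) * (fromℕℚ b - fromℕℚ p - 1ℚ)
  shuffle : ∀ x y z → (-1ℤ ℤ.* x) ℤ.* (y ℤ.* z) ≡ ℤ.- (x ℤ.* y ℤ.* z)
  shuffle = ℤSolver.+-*-Solver.solve 3 (λ x y z → (con′ -1ℤ :*′ x) :*′ (y :*′ z) :=′ :-′ (x :*′ y :*′ z)) refl
    where open ℤSolver.+-*-Solver using () renaming (con to con′; :-_ to :-′_; _:=_ to _:=′_; _:*_ to _:*′_)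
  dd : fromℕℚ (suc (suc p) ! ℕ.* suc p !) ≡ s′ * s * d
  dd = begin
    fromℕℚ (suc (suc p) ! ℕ.* suc p !) ≡⟨ fromℕℚ-* (suc (suc p) !) (suc p !) ⟩
    fromℕℚ (suc (suc p) !) * fromℕℚ (suc p !) ≡⟨ cong₂ _*_ (fromℕℚ-* (suc (suc p)) (suc p !)) (fromℕℚ-* (suc p) (p !)) ⟩
    (s′ * e′) * (s * e) ≡⟨ solve 4 (λ s′ s e′ e → (s′ :* e′) :* (s :* e) := s′ :* s :* (e′ :* e)) refl s′ s e′ e ⟩
    s′ * s * (e′ * e) ≡⟨ cong (s′ * s *_) (fromℕℚ-* (suc p !) (p !)) ⟨
    s′ * s * d ∎
    where
    e  = fromℕℚ (p !)
    e′ = fromℕℚ (suc p !)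
  ιf : ι (f p) ≡ v
  ιf = trans (ι-* (+ b ℤ.- + p) (+ b ℤ.- + p ℤ.- + 1))
         (cong₂ _*_ (ι-- (+ b) (+ p)) (trans (ι-- (+ b ℤ.- + p) (+ 1)) (cong (_- 1ℚ) (ι-- (+ b) (+ p)))))

-- With both squares factored, the quotient of the products for ℓ+1 and ℓ telescopes over m and
-- leaves only boundary factors. Cross-multiplied, the relation stays meaningful when one of these
-- vanishes.
I-ratio : ∀ b ℓ p → let β = fromℕℚ b; λ′ = fromℕℚ ℓ; π = fromℕℚ p in
          I b (suc ℓ) p * ((1ℚ + λ′ + β - π) * (λ′ - β)) ≡ I b ℓ p * ((λ′ + π - β) * (1ℚ + λ′ + β))
I-ratio b ℓ zero =
  solve 2 (λ β l → con 1ℚ :* ((con 1ℚ :+ l :+ β :- con 0ℚ) :* (l :- β)) :=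
                   con 1ℚ :* ((l :+ con 0ℚ :- β) :* (con 1ℚ :+ l :+ β))) refl (fromℕℚ b) (fromℕℚ ℓ)
I-ratio b ℓ (suc p) = *-cancelˡ-suc p (*-cancelˡ-suc p (begin
  s * (s * (A′ * ((1ℚ + l + β - s) * (l - β))))
    ≡⟨ assoc′ s A′ _ ⟩
  (s * (s * A′)) * ((1ℚ + l + β - s) * (l - β))
    ≡⟨ cong₂ _*_ (trans (I-suc b (suc ℓ) p) (cong (λ z → A * ((z - (β - π)) * (z + (β - π)))) (fromℕℚ-suc ℓ))) (cong (λ z → (1ℚ + l + β - z) * (l - β)) (fromℕℚ-suc p)) ⟩
  (A * ((1ℚ + l - (β - π)) * (1ℚ + l + (β - π)))) * ((1ℚ + l + β - (1ℚ + π)) * (l - β))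
    ≡⟨ solve 4 (λ A l β π → (A :* ((con 1ℚ :+ l :- (β :- π)) :* (con 1ℚ :+ l :+ (β :- π)))) :* ((con 1ℚ :+ l :+ β :- (con 1ℚ :+ π)) :* (l :- β))
                 := (A :* ((con 1ℚ :+ l :+ β :- π) :* (l :- β))) :* ((con 1ℚ :+ l :- β :+ π) :* (l :+ β :- π))) refl A l β π ⟩
  (A * ((1ℚ + l + β - π) * (l - β))) * ((1ℚ + l - β + π) * (l + β - π))
    ≡⟨ cong (_* ((1ℚ + l - β + π) * (l + β - π))) (I-ratio b ℓ p) ⟩
  (B * ((l + π - β) * (1ℚ + l + β))) * ((1ℚ + l - β + π) * (l + β - π))
    ≡⟨ solve 4 (λ B l β π → (B :* ((l :+ π :- β) :* (con 1ℚ :+ l :+ β))) :* ((con 1ℚ :+ l :- β :+ π) :* (l :+ β :- π))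
                 := (B :* ((l :- (β :- π)) :* (l :+ (β :- π)))) :* ((l :+ (con 1ℚ :+ π) :- β) :* (con 1ℚ :+ l :+ β))) refl B l β π ⟩
  (B * ((l - (β - π)) * (l + (β - π)))) * ((l + (1ℚ + π) - β) * (1ℚ + l + β))
    ≡⟨ cong₂ _*_ (I-suc b ℓ p) (cong (λ z → (l + z - β) * (1ℚ + l + β)) (fromℕℚ-suc p)) ⟨
  (s * (s * B′)) * ((l + s - β) * (1ℚ + l + β))
    ≡⟨ assoc′ s B′ _ ⟨
  s * (s * (B′ * ((l + s - β) * (1ℚ + l + β)))) ∎))
  where
  open ≡-Reasoning
  l = fromℕℚ ℓ
  β = fromℕℚ b
  π = fromℕℚ p
  s = fromℕℚ (suc p)
  A = I b (suc ℓ) p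
  B = I b ℓ p
  A′ = I b (suc ℓ) (suc p)
  B′ = I b ℓ (suc p)
  assoc′ : ∀ s x y → s * (s * (x * y)) ≡ (s * (s * x)) * y
  assoc′ = solve 3 (λ s x y → s :* (s :* (x :* y)) := (s :* (s :* x)) :* y) refl

-- The coefficient of r^p in (1+r)∂_r F, for F = ∑ F_p r^p.
θℚ : (ℕ → ℚ) → ℕ → ℚ
θℚ F p = fromℕℚ (suc p) * F (suc p) + fromℕℚ p * F p

-- This is the ℓ-difference of the identity `θI`. After multiplication by p+1 and elimination of the
-- r^(p+1) coefficients by `I-suc`, the two sides differ exactly by the difference of the two sides
-- of `I-ratio`.
θ-ΔI : ∀ b ℓ p → θℚ (I b (suc ℓ)) p - θℚ (I b ℓ) p ≡
       fromℕℚ b * (I b (suc ℓ) p - I b ℓ p) + (fromℕℚ (suc ℓ) * I b (suc ℓ) p + fromℕℚ ℓ * I b ℓ p)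
θ-ΔI b ℓ p = *-cancelˡ-suc p (begin
  s * ((s * A′ + π * A) - (s * B′ + π * B))
    ≡⟨ solve 6 (λ s π A B A′ B′ → s :* ((s :* A′ :+ π :* A) :- (s :* B′ :+ π :* B)) := s :* (s :* A′) :- s :* (s :* B′) :+ s :* π :* (A :- B)) refl s π A B A′ B′ ⟩
  s * (s * A′) - s * (s * B′) + s * π * (A - B)
    ≡⟨ cong₂ (λ x y → x - y + s * π * (A - B)) (trans (I-suc b (suc ℓ) p) (cong (λ z → A * ((z - (β - π)) * (z + (β - π)))) (fromℕℚ-suc ℓ))) (I-suc b ℓ p) ⟩
  A * ((1ℚ + l - (β - π)) * (1ℚ + l + (β - π))) - B * ((l - (β - π)) * (l + (β - π))) + s * π * (A - B)
    ≡⟨ cong (λ z → A * ((1ℚ + l - (β - π)) * (1ℚ + l + (β - π))) - B * ((l - (β - π)) * (l + (β - π))) + z * π * (A - B)) (fromℕℚ-suc p) ⟩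
  A * ((1ℚ + l - (β - π)) * (1ℚ + l + (β - π))) - B * ((l - (β - π)) * (l + (β - π))) + (1ℚ + π) * π * (A - B)
    ≡⟨ solve 5 (λ A B l β π →
         A :* ((con 1ℚ :+ l :- (β :- π)) :* (con 1ℚ :+ l :+ (β :- π))) :- B :* ((l :- (β :- π)) :* (l :+ (β :- π))) :+ (con 1ℚ :+ π) :* π :* (A :- B)
         := (A :* ((con 1ℚ :+ l :+ β :- π) :* (l :- β)) :- B :* ((l :+ π :- β) :* (con 1ℚ :+ l :+ β)))
            :+ (con 1ℚ :+ π) :* (β :* (A :- B) :+ ((con 1ℚ :+ l) :* A :+ l :* B))) refl A B l β π ⟩
  (A * ((1ℚ + l + β - π) * (l - β)) - B * ((l + π - β) * (1ℚ + l + β))) + (1ℚ + π) * (β * (A - B) + ((1ℚ + l) * A + l * B))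
    ≡⟨ cong (_+ ((1ℚ + π) * (β * (A - B) + ((1ℚ + l) * A + l * B)))) (trans (cong (_- (B * ((l + π - β) * (1ℚ + l + β)))) (I-ratio b ℓ p)) (ℚₚ.+-inverseʳ (B * ((l + π - β) * (1ℚ + l + β))))) ⟩
  0ℚ + (1ℚ + π) * (β * (A - B) + ((1ℚ + l) * A + l * B))
    ≡⟨ ℚₚ.+-identityˡ _ ⟩
  (1ℚ + π) * (β * (A - B) + ((1ℚ + l) * A + l * B))
    ≡⟨ cong₂ (λ x y → x * (β * (A - B) + (y * A + l * B))) (fromℕℚ-suc p) (fromℕℚ-suc ℓ) ⟨
  s * (β * (A - B) + (fromℕℚ (suc ℓ) * A + l * B)) ∎)
  where
  open ≡-Reasoning
  l = fromℕℚ ℓ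
  β = fromℕℚ b
  π = fromℕℚ p
  s = fromℕℚ (suc p)
  A = I b (suc ℓ) p
  B = I b ℓ p
  A′ = I b (suc ℓ) (suc p)
  B′ = I b ℓ (suc p)

-- I and J both obey two-term recurrences, so a proportionality between them propagates once the
-- weight `w` obeys the quotient recurrence. For ℓ = 0 and ℓ = 1 the factors of I are those of J up
-- to a shift, and the weight collects the two unmatched boundary factors.
I-J-step : ∀ b ℓ p {w w′} → let β = fromℕℚ b; l = fromℕℚ ℓ; π = fromℕℚ p; s = fromℕℚ (suc p) in
           w * ((l - (β - s)) * (l + (β - s))) ≡ - ((β - π) * (β - π - 1ℚ)) * w′ →
           s * I b ℓ (suc p) ≡ J b (suc p) * w →
           fromℕℚ (suc (suc p)) * I b ℓ (suc (suc p)) ≡ J b (suc (suc p)) * w′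
I-J-step b ℓ p {w} {w′} w-step eq = *-cancelˡ-suc p (*-cancelˡ-suc (suc p) (begin
  s′ * (s * (s′ * i′))     ≡⟨ solve 3 (λ s′ s i → s′ :* (s :* (s′ :* i)) := s :* (s′ :* (s′ :* i))) refl s′ s i′ ⟩
  s * (s′ * (s′ * i′))     ≡⟨ cong (s *_) (I-suc b ℓ (suc p)) ⟩
  s * (i * v)              ≡⟨ ℚₚ.*-assoc s i v ⟨
  (s * i) * v              ≡⟨ cong (_* v) eq ⟩
  (j * w) * v              ≡⟨ ℚₚ.*-assoc j w v ⟩
  j * (w * v)              ≡⟨ cong (j *_) w-step ⟩
  j * (- t * w′)           ≡⟨ solve 3 (λ j t w → j :* (:- t :* w) := (:- (j :* t)) :* w) refl j t w′ ⟩
  (- (j * t)) * w′         ≡⟨ cong (_* w′) (J-suc b p) ⟨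
  (s′ * (s * j′)) * w′     ≡⟨ solve 4 (λ s′ s j w → (s′ :* (s :* j)) :* w := s′ :* (s :* (j :* w))) refl s′ s j′ w′ ⟩
  s′ * (s * (j′ * w′))     ∎))
  where
  open ≡-Reasoning
  s = fromℕℚ (suc p)
  s′ = fromℕℚ (suc (suc p))
  i = I b ℓ (suc p)
  i′ = I b ℓ (suc (suc p))
  j = J b (suc p)
  j′ = J b (suc (suc p))
  β = fromℕℚ b
  v = (fromℕℚ ℓ - (β - s)) * (fromℕℚ ℓ + (β - s))
  t = (β - fromℕℚ p) * (β - fromℕℚ p - 1ℚ)

I-J-base : ∀ b ℓ {w} → let β = fromℕℚ b; l = fromℕℚ ℓ in (l - β) * (l + β) ≡ w → 1ℚ * I b ℓ 1 ≡ J b 1 * w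
I-J-base b ℓ {w} eq = begin
  1ℚ * I b ℓ 1         ≡⟨ ℚₚ.*-identityˡ (1ℚ * I b ℓ 1) ⟨
  1ℚ * (1ℚ * I b ℓ 1)  ≡⟨ I-suc b ℓ 0 ⟩
  1ℚ * ((l - (β - 0ℚ)) * (l + (β - 0ℚ))) ≡⟨ solve 2 (λ l β → con 1ℚ :* ((l :- (β :- con 0ℚ)) :* (l :+ (β :- con 0ℚ))) := con 1ℚ :* ((l :- β) :* (l :+ β))) refl l β ⟩
  1ℚ * ((l - β) * (l + β)) ≡⟨ cong (1ℚ *_) eq ⟩
  1ℚ * w ∎
  where
  open ≡-Reasoning
  l = fromℕℚ ℓ
  β = fromℕℚ b

I₁-J : ∀ b p → let β = fromℕℚ b; s = fromℕℚ (suc p) in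
       s * I b 1 (suc p) ≡ J b (suc p) * ((s - β) * (β + 1ℚ))
I₁-J b zero = I-J-base b 1 (solve 1 (λ β → (con 1ℚ :- β) :* (con 1ℚ :+ β) := (con 1ℚ :- β) :* (β :+ con 1ℚ)) refl (fromℕℚ b))
I₁-J b (suc p) = I-J-step b 1 p (step (fromℕℚ b) (fromℕℚ p) (fromℕℚ-suc p) (fromℕℚ-suc (suc p))) (I₁-J b p)
  where
  step : ∀ β π {s s′} → s ≡ 1ℚ + π → s′ ≡ 1ℚ + s →
         ((s - β) * (β + 1ℚ)) * ((1ℚ - (β - s)) * (1ℚ + (β - s))) ≡ - ((β - π) * (β - π - 1ℚ)) * ((s′ - β) * (β + 1ℚ))
  step β π refl refl =
    solve 2 (λ β π → ((con 1ℚ :+ π :- β) :* (β :+ con 1ℚ)) :* ((con 1ℚ :- (β :- (con 1ℚ :+ π))) :* (con 1ℚ :+ (β :- (con 1ℚ :+ π))))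
                     := (:- ((β :- π) :* (β :- π :- con 1ℚ))) :* ((con 1ℚ :+ (con 1ℚ :+ π) :- β) :* (β :+ con 1ℚ))) refl β π

I₀-J : ∀ b p → let β = fromℕℚ b; s = fromℕℚ (suc p) in
       s * I b 0 (suc p) ≡ J b (suc p) * (β * (s - 1ℚ - β))
I₀-J b zero = I-J-base b 0 (solve 1 (λ β → (con 0ℚ :- β) :* (con 0ℚ :+ β) := β :* (con 1ℚ :- con 1ℚ :- β)) refl (fromℕℚ b))
I₀-J b (suc p) = I-J-step b 0 p (step (fromℕℚ b) (fromℕℚ p) (fromℕℚ-suc p) (fromℕℚ-suc (suc p))) (I₀-J b p)
  where
  step : ∀ β π {s s′} → s ≡ 1ℚ + π → s′ ≡ 1ℚ + s →
         (β * (s - 1ℚ - β)) * ((0ℚ - (β - s)) * (0ℚ + (β - s))) ≡ - ((β - π) * (β - π - 1ℚ)) * (β * (s′ - 1ℚ - β))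
  step β π refl refl =
    solve 2 (λ β π → (β :* (con 1ℚ :+ π :- con 1ℚ :- β)) :* ((con 0ℚ :- (β :- (con 1ℚ :+ π))) :* (con 0ℚ :+ (β :- (con 1ℚ :+ π))))
                     := (:- ((β :- π) :* (β :- π :- con 1ℚ))) :* (β :* (con 1ℚ :+ (con 1ℚ :+ π) :- con 1ℚ :- β))) refl β π

-- The weights in `I₁-J` and `I₀-J` differ by exactly `s`, which is then cancelled.
J≡I₁-I₀ : ∀ b p → J b p ≡ I b 1 p - I b 0 p
J≡I₁-I₀ b zero    = refl
J≡I₁-I₀ b (suc p) = *-cancelˡ-suc p (sym (begin
  s * (i₁ - i₀)       ≡⟨ solve 3 (λ s x y → s :* (x :- y) := s :* x :- s :* y) refl s i₁ i₀ ⟩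
  s * i₁ - s * i₀     ≡⟨ cong₂ _-_ (I₁-J b p) (I₀-J b p) ⟩
  j * ((s - β) * (β + 1ℚ)) - j * (β * (s - 1ℚ - β))
    ≡⟨ solve 3 (λ j s β → j :* ((s :- β) :* (β :+ con 1ℚ)) :- j :* (β :* (s :- con 1ℚ :- β)) := s :* j) refl j s β ⟩
  s * j               ∎))
  where
  open ≡-Reasoning
  s = fromℕℚ (suc p)
  β = fromℕℚ b
  j = J b (suc p)
  i₁ = I b 1 (suc p)
  i₀ = I b 0 (suc p)

-- The factor m = 0 of the product is b^2 - b^2, so I(b,b;r) = 1.
I-diagonal : ∀ b p → I b b (suc p) ≡ 0ℚ
I-diagonal b p = *-cancelˡ-suc p (*-cancelˡ-suc p (trans (I-suc b b p) (trans (vanish p) (sym (trans (cong (s *_) (ℚₚ.*-zeroʳ s)) (ℚₚ.*-zeroʳ s))))))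
  where
  s = fromℕℚ (suc p)
  β = fromℕℚ b
  vanish : ∀ p → I b b p * ((β - (β - fromℕℚ p)) * (β + (β - fromℕℚ p))) ≡ 0ℚ
  vanish zero    = solve 1 (λ β → con 1ℚ :* ((β :- (β :- con 0ℚ)) :* (β :+ (β :- con 0ℚ))) := con 0ℚ) refl β
  vanish (suc p) = trans (cong (_* v) (I-diagonal b p)) (ℚₚ.*-zeroˡ v)
    where v = (β - (β - fromℕℚ (suc p))) * (β + (β - fromℕℚ (suc p)))

-- This is `θ-ΔI` at ℓ = 0, where the term ℓ I(ℓ) drops out.
θJ : ∀ b p → θℚ (J b) p - fromℕℚ b * J b p ≡ I b 1 p
θJ b p = begin
  (s * J b (suc p) + π * J b p) - β * J b p
    ≡⟨ cong₂ (λ x y → (s * x + π * y) - β * y) (J≡I₁-I₀ b (suc p)) (J≡I₁-I₀ b p) ⟩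
  (s * (a′ - c′) + π * (a - c)) - β * (a - c)
    ≡⟨ solve 7 (λ s π β a c a′ c′ → (s :* (a′ :- c′) :+ π :* (a :- c)) :- β :* (a :- c) := ((s :* a′ :+ π :* a) :- (s :* c′ :+ π :* c)) :- β :* (a :- c)) refl s π β a c a′ c′ ⟩
  (θℚ (I b 1) p - θℚ (I b 0) p) - β * (a - c)
    ≡⟨ cong (_- (β * (a - c))) (θ-ΔI b 0 p) ⟩
  (β * (a - c) + (1ℚ * a + 0ℚ * c)) - β * (a - c)
    ≡⟨ solve 3 (λ β a c → (β :* (a :- c) :+ (con 1ℚ :* a :+ con 0ℚ :* c)) :- β :* (a :- c) := a) refl β a c ⟩
  a ∎
  where
  open ≡-Reasoning
  s = fromℕℚ (suc p)
  π = fromℕℚ p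
  β = fromℕℚ b
  a = I b 1 p
  c = I b 0 p
  a′ = I b 1 (suc p)
  c′ = I b 0 (suc p)

-- Finite sums and convolutions

∑< : ℕ → (ℕ → ℚ) → ℚ
∑< n f = ∑[ i < n ] f (toℕ i)

interchange : ∀ a b c d → (a + b) + (c + d) ≡ (a + c) + (b + d)
interchange = solve 4 (λ a b c d → (a :+ b) :+ (c :+ d) := (a :+ c) :+ (b :+ d)) refl

∑<-cong : ∀ n {f g : ℕ → ℚ} → (∀ i → f i ≡ g i) → ∑< n f ≡ ∑< n g
∑<-cong n eq = sum-cong-≗ {n} (eq ∘ toℕ)

∑<-last : ∀ n f → ∑< (suc n) f ≡ ∑< n f + f n
∑<-last n f = trans (sum-init-last {n} (f ∘ toℕ))
  (cong₂ _+_ (sum-cong-≗ {n} (cong f ∘ toℕ-inject₁)) (cong f (toℕ-fromℕ n)))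

∑<-zero : ∀ n → ∑< n (λ _ → 0ℚ) ≡ 0ℚ
∑<-zero zero    = refl
∑<-zero (suc n) = trans (ℚₚ.+-identityˡ _) (∑<-zero n)

∑<-+ : ∀ n f g → ∑< n (λ i → f i + g i) ≡ ∑< n f + ∑< n g
∑<-+ zero    f g = refl
∑<-+ (suc n) f g = trans (cong (_+_ (f 0 + g 0)) (∑<-+ n (f ∘ suc) (g ∘ suc)))
                         (interchange (f 0) (g 0) (∑< n (f ∘ suc)) (∑< n (g ∘ suc)))

∑<-* : ∀ n q f → ∑< n (λ i → q * f i) ≡ q * ∑< n f
∑<-* zero    q f = sym (ℚₚ.*-zeroʳ q)
∑<-* (suc n) q f = trans (cong (_+_ (q * f 0)) (∑<-* n q (f ∘ suc)))
                         (sym (ℚₚ.*-distribˡ-+ q (f 0) (∑< n (f ∘ suc))))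

-- The summand receives both exponents, so that the sum can be flipped and `conv-cong` can supply i
-- + j = a.
conv : ℕ → (ℕ → ℕ → ℚ) → ℚ
conv a T = ∑[ i ≤ a ] T (toℕ i) (a ∸ toℕ i)

conv-cong : ∀ a {T U : ℕ → ℕ → ℚ} → (∀ i j → i ℕ.+ j ≡ a → T i j ≡ U i j) → conv a T ≡ conv a U
conv-cong zero    eq = cong (_+ 0ℚ) (eq 0 0 refl)
conv-cong (suc a) eq = cong₂ _+_ (eq 0 (suc a) refl) (conv-cong a (λ i j i+j≡a → eq (suc i) j (cong suc i+j≡a)))

conv-zero : ∀ a → conv a (λ _ _ → 0ℚ) ≡ 0ℚ
conv-zero a = ∑<-zero (suc a)

conv-+ : ∀ a T U → conv a (λ i j → T i j + U i j) ≡ conv a T + conv a U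
conv-+ a T U = ∑<-+ (suc a) (λ i → T i (a ∸ i)) (λ i → U i (a ∸ i))

conv-* : ∀ a q T → conv a (λ i j → q * T i j) ≡ q * conv a T
conv-* a q T = ∑<-* (suc a) q (λ i → T i (a ∸ i))

conv-last : ∀ a T → conv (suc a) T ≡ conv a (λ i j → T i (suc j)) + T (suc a) 0
conv-last zero    T = solve 2 (λ x y → x :+ (y :+ con 0ℚ) := (x :+ con 0ℚ) :+ y) refl (T 0 1) (T 1 0)
conv-last (suc a) T = trans (cong (_+_ (T 0 (suc (suc a)))) (conv-last a (T ∘ suc)))
                            (sym (ℚₚ.+-assoc (T 0 (suc (suc a))) _ _))

conv-flip : ∀ a T → conv a T ≡ conv a (flip T)
conv-flip zero    T = refl
conv-flip (suc a) T = begin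
  T 0 (suc a) + conv a (T ∘ suc)                   ≡⟨ ℚₚ.+-comm (T 0 (suc a)) _ ⟩
  conv a (T ∘ suc) + T 0 (suc a)                   ≡⟨ cong (_+ T 0 (suc a)) (conv-flip a (T ∘ suc)) ⟩
  conv a (λ i j → T (suc j) i) + T 0 (suc a)       ≡⟨ conv-last a (flip T) ⟨
  conv (suc a) (flip T)                            ∎
  where open ≡-Reasoning

-- Both sides run over the triples with j + m + k = a; the induction splits off the terms with j =
-- 0.
conv-assoc : ∀ a (T : ℕ → ℕ → ℕ → ℚ) →
             conv a (λ i k → conv i (λ j m → T j m k)) ≡ conv a (λ j i → conv i (T j))
conv-assoc zero    T = refl
conv-assoc (suc a) T = begin
  (T 0 0 (suc a) + 0ℚ) + conv a (λ i k → T 0 (suc i) k + conv i (λ j m → T (suc j) m k))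
    ≡⟨ cong₂ _+_ (ℚₚ.+-identityʳ (T 0 0 (suc a))) (conv-+ a (λ i k → T 0 (suc i) k) (λ i k → conv i (λ j m → T (suc j) m k))) ⟩
  T 0 0 (suc a) + (conv a (T 0 ∘ suc) + conv a (λ i k → conv i (λ j m → T (suc j) m k)))
    ≡⟨ ℚₚ.+-assoc (T 0 0 (suc a)) (conv a (T 0 ∘ suc)) _ ⟨
  conv (suc a) (T 0) + conv a (λ i k → conv i (λ j m → T (suc j) m k))
    ≡⟨ cong (_+_ (conv (suc a) (T 0))) (conv-assoc a (T ∘ suc)) ⟩
  conv (suc a) (T 0) + conv a (λ j i → conv i (T (suc j))) ∎
  where open ≡-Reasoning

-- The factor a+1 is distributed as i + j. In each half one boundary term has weight 0, and dropping
-- it produces the shifted index.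
conv-leibniz : ∀ a T → fromℕℚ (suc a) * conv (suc a) T ≡
               conv a (λ i j → fromℕℚ (suc i) * T (suc i) j) + conv a (λ i j → fromℕℚ (suc j) * T i (suc j))
conv-leibniz a T = begin
  fromℕℚ (suc a) * conv (suc a) T
    ≡⟨ conv-* (suc a) (fromℕℚ (suc a)) T ⟨
  conv (suc a) (λ i j → fromℕℚ (suc a) * T i j)
    ≡⟨ conv-cong (suc a) (λ i j i+j≡a → trans (cong (λ n → fromℕℚ n * T i j) (sym i+j≡a))
         (trans (cong (_* T i j) (fromℕℚ-+ i j)) (ℚₚ.*-distribʳ-+ (T i j) (fromℕℚ i) (fromℕℚ j)))) ⟩
  conv (suc a) (λ i j → fromℕℚ i * T i j + fromℕℚ j * T i j)
    ≡⟨ conv-+ (suc a) (λ i j → fromℕℚ i * T i j) (λ i j → fromℕℚ j * T i j) ⟩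
  conv (suc a) (λ i j → fromℕℚ i * T i j) + conv (suc a) (λ i j → fromℕℚ j * T i j)
    ≡⟨ cong₂ _+_ (trans (cong (_+ left) (ℚₚ.*-zeroˡ (T 0 (suc a)))) (ℚₚ.+-identityˡ left))
         (trans (conv-last a (λ i j → fromℕℚ j * T i j))
                (trans (cong (_+_ right) (ℚₚ.*-zeroˡ (T (suc a) 0))) (ℚₚ.+-identityʳ right))) ⟩
  left + right ∎
  where
  open ≡-Reasoning
  left right : ℚ
  left  = conv a (λ i j → fromℕℚ (suc i) * T (suc i) j)
  right = conv a (λ i j → fromℕℚ (suc j) * T i (suc j))

-- From ℓ to ℓ+1, (θ-b) I(ℓ) grows by (ℓ+1) I(ℓ+1) + ℓ I(ℓ) according to `θ-ΔI`, and ℓ I(ℓ) grows by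
-- (ℓ+1) I(ℓ+1) - ℓ I(ℓ). The total 2(ℓ+1) I(ℓ+1) is the next summand of `S`, so H + L - S does not
-- depend on ℓ and can be evaluated at ℓ = b. This is the origin of the sum up to b in D^str.
θI : ∀ b ℓ p → let S = λ n → ∑< n (λ i → fromℕℚ (2 ℕ.* suc i) * I b (suc i) p) in
     θℚ (I b ℓ) p - fromℕℚ b * I b ℓ p ≡ (- (fromℕℚ ℓ * I b ℓ p) + S ℓ) - S b
θI b ℓ p = begin
  H ℓ                                    ≡⟨ solve 3 (λ h l s → h := (:- l :+ s) :+ (h :+ l :- s)) refl (H ℓ) (L ℓ) (S ℓ) ⟩
  (- L ℓ + S ℓ) + (H ℓ + L ℓ - S ℓ)      ≡⟨ cong (_+_ (- L ℓ + S ℓ)) (trans (const-in-ℓ ℓ) (trans (sym (const-in-ℓ b)) at-b)) ⟩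
  (- L ℓ + S ℓ) - S b                    ∎
  where
  open ≡-Reasoning
  β = fromℕℚ b
  S H L : ℕ → ℚ
  S n = ∑< n (λ i → fromℕℚ (2 ℕ.* suc i) * I b (suc i) p)
  H ℓ = θℚ (I b ℓ) p - β * I b ℓ p
  L ℓ = fromℕℚ ℓ * I b ℓ p

  step : ∀ ℓ → H (suc ℓ) + L (suc ℓ) - S (suc ℓ) ≡ H ℓ + L ℓ - S ℓ
  step ℓ = begin
    (t′ - β * i′) + s * i′ - S (suc ℓ)
      ≡⟨ cong (λ z → (t′ - β * i′) + s * i′ - z) (trans (∑<-last ℓ (λ i → fromℕℚ (2 ℕ.* suc i) * I b (suc i) p)) (cong (λ z → S ℓ + z * i′) (fromℕℚ-* 2 (suc ℓ)))) ⟩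
    (t′ - β * i′) + s * i′ - (S ℓ + (fromℕℚ 2 * s) * i′)
      ≡⟨ solve 6 (λ t t′ β i′ s S → (t′ :- β :* i′) :+ s :* i′ :- (S :+ (con (fromℕℚ 2) :* s) :* i′)
                    := (t′ :- t) :+ (t :- β :* i′ :- s :* i′ :- S)) refl t t′ β i′ s (S ℓ) ⟩
    (t′ - t) + (t - β * i′ - s * i′ - S ℓ)
      ≡⟨ cong (_+ (t - β * i′ - s * i′ - S ℓ)) (θ-ΔI b ℓ p) ⟩
    (β * (i′ - i) + (s * i′ + l * i)) + (t - β * i′ - s * i′ - S ℓ)
      ≡⟨ solve 7 (λ t β i i′ s l S → (β :* (i′ :- i) :+ (s :* i′ :+ l :* i)) :+ (t :- β :* i′ :- s :* i′ :- S)
                    := (t :- β :* i) :+ l :* i :- S) refl t β i i′ s l (S ℓ) ⟩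
    (t - β * i) + l * i - S ℓ ∎
    where
    t  = θℚ (I b ℓ) p
    t′ = θℚ (I b (suc ℓ)) p
    i  = I b ℓ p
    i′ = I b (suc ℓ) p
    s  = fromℕℚ (suc ℓ)
    l  = fromℕℚ ℓ

  const-in-ℓ : ∀ ℓ → H ℓ + L ℓ - S ℓ ≡ H 0 + L 0 - S 0
  const-in-ℓ zero    = refl
  const-in-ℓ (suc ℓ) = trans (step ℓ) (const-in-ℓ ℓ)

  θ-diagonal : ∀ p → θℚ (I b b) p ≡ 0ℚ
  θ-diagonal zero    = trans (cong (λ z → fromℕℚ 1 * z + 0ℚ * I b b 0) (I-diagonal b 0)) refl
  θ-diagonal (suc p) = trans (cong₂ (λ y z → fromℕℚ (suc (suc p)) * y + fromℕℚ (suc p) * z) (I-diagonal b (suc p)) (I-diagonal b p))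
    (trans (cong₂ _+_ (ℚₚ.*-zeroʳ (fromℕℚ (suc (suc p)))) (ℚₚ.*-zeroʳ (fromℕℚ (suc p)))) (ℚₚ.+-identityˡ 0ℚ))

  -- I(b,b;r) = 1 is killed by θ, so H b is just - L b.
  at-b : H b + L b - S b ≡ - S b
  at-b = begin
    (θℚ (I b b) p - L b) + L b - S b  ≡⟨ cong (λ z → (z - L b) + L b - S b) (θ-diagonal p) ⟩
    (0ℚ - L b) + L b - S b            ≡⟨ solve 2 (λ x s → (con 0ℚ :- x) :+ x :- s := :- s) refl (L b) (S b) ⟩
    - S b                             ∎

-- Cauchy products of coefficient functions

-- The two restrictions serve different ends: the bound on the degree gives congruence for truncated
-- equality, and the equal length lets `∑x`, whose range depends on the length, pass through a
-- product.
cauchy-cong : ∀ α {f f′ g g′ : Monomial → ℚ} →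
              (∀ β → length β ≡ length α → degree β ≤ degree α → f β ≡ f′ β) →
              (∀ β → length β ≡ length α → degree β ≤ degree α → g β ≡ g′ β) →
              cauchy f g α ≡ cauchy f′ g′ α
cauchy-cong []      f≡f′ g≡g′ = cong₂ _*_ (f≡f′ [] refl z≤n) (g≡g′ [] refl z≤n)
cauchy-cong (a ∷ α) f≡f′ g≡g′ = conv-cong a (λ i j i+j≡a → cauchy-cong α
  (λ β len deg → f≡f′ (i ∷ β) (cong suc len) (ℕₚ.+-mono-≤ (ℕₚ.m+n≤o⇒m≤o i (ℕₚ.≤-reflexive i+j≡a)) deg))
  (λ β len deg → g≡g′ (j ∷ β) (cong suc len) (ℕₚ.+-mono-≤ (ℕₚ.m+n≤o⇒n≤o i (ℕₚ.≤-reflexive i+j≡a)) deg)))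

cauchy-cong-≗ : ∀ α {f f′ g g′ : Monomial → ℚ} → (∀ β → f β ≡ f′ β) → (∀ β → g β ≡ g′ β) →
                cauchy f g α ≡ cauchy f′ g′ α
cauchy-cong-≗ α f≗f′ g≗g′ = cauchy-cong α (λ β _ _ → f≗f′ β) (λ β _ _ → g≗g′ β)

cauchy-comm : ∀ f g α → cauchy f g α ≡ cauchy g f α
cauchy-comm f g []      = ℚₚ.*-comm (f []) (g [])
cauchy-comm f g (a ∷ α) = trans
  (conv-cong a (λ i j _ → cauchy-comm (f ∘ (i ∷_)) (g ∘ (j ∷_)) α))
  (conv-flip a (λ i j → cauchy (g ∘ (j ∷_)) (f ∘ (i ∷_)) α))

cauchy-+ˡ : ∀ f f′ g α → cauchy (λ β → f β + f′ β) g α ≡ cauchy f g α + cauchy f′ g α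
cauchy-+ˡ f f′ g []      = ℚₚ.*-distribʳ-+ (g []) (f []) (f′ [])
cauchy-+ˡ f f′ g (a ∷ α) = trans
  (conv-cong a (λ i j _ → cauchy-+ˡ (f ∘ (i ∷_)) (f′ ∘ (i ∷_)) (g ∘ (j ∷_)) α))
  (conv-+ a (λ i j → cauchy (f ∘ (i ∷_)) (g ∘ (j ∷_)) α) (λ i j → cauchy (f′ ∘ (i ∷_)) (g ∘ (j ∷_)) α))

cauchy-*ˡ : ∀ q f g α → cauchy (λ β → q * f β) g α ≡ q * cauchy f g α
cauchy-*ˡ q f g []      = ℚₚ.*-assoc q (f []) (g [])
cauchy-*ˡ q f g (a ∷ α) = trans
  (conv-cong a (λ i j _ → cauchy-*ˡ q (f ∘ (i ∷_)) (g ∘ (j ∷_)) α))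
  (conv-* a q (λ i j → cauchy (f ∘ (i ∷_)) (g ∘ (j ∷_)) α))

cauchy-zeroˡ : ∀ g α → cauchy (λ _ → 0ℚ) g α ≡ 0ℚ
cauchy-zeroˡ g []      = ℚₚ.*-zeroˡ (g [])
cauchy-zeroˡ g (a ∷ α) = trans (conv-cong a (λ i j _ → cauchy-zeroˡ (g ∘ (j ∷_)) α)) (conv-zero a)

cauchy-∑ˡ : ∀ n (F : ℕ → Monomial → ℚ) g α → cauchy (λ β → ∑< n (λ i → F i β)) g α ≡ ∑< n (λ i → cauchy (F i) g α)
cauchy-∑ˡ zero    F g α = cauchy-zeroˡ g α
cauchy-∑ˡ (suc n) F g α = trans (cauchy-+ˡ (F 0) (λ β → ∑< n (λ i → F (suc i) β)) g α)
                                (cong (_+_ (cauchy (F 0) g α)) (cauchy-∑ˡ n (F ∘ suc) g α))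

cauchy-assoc : ∀ f g h α → cauchy (cauchy f g) h α ≡ cauchy f (cauchy g h) α
cauchy-assoc f g h []      = ℚₚ.*-assoc (f []) (g []) (h [])
cauchy-assoc f g h (a ∷ α) = begin
  conv a (λ i k → cauchy (λ β → conv i (λ j m → cauchy (f ∘ (j ∷_)) (g ∘ (m ∷_)) β)) (h ∘ (k ∷_)) α)
    ≡⟨ conv-cong a (λ i k _ → cauchy-∑ˡ (suc i) (λ j → cauchy (f ∘ (j ∷_)) (g ∘ ((i ∸ j) ∷_))) (h ∘ (k ∷_)) α) ⟩
  conv a (λ i k → conv i (λ j m → cauchy (cauchy (f ∘ (j ∷_)) (g ∘ (m ∷_))) (h ∘ (k ∷_)) α))
    ≡⟨ conv-cong a (λ i k _ → conv-cong i (λ j m _ → cauchy-assoc (f ∘ (j ∷_)) (g ∘ (m ∷_)) (h ∘ (k ∷_)) α)) ⟩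
  conv a (λ i k → conv i (λ j m → cauchy (f ∘ (j ∷_)) (cauchy (g ∘ (m ∷_)) (h ∘ (k ∷_))) α))
    ≡⟨ conv-assoc a (λ j m k → cauchy (f ∘ (j ∷_)) (cauchy (g ∘ (m ∷_)) (h ∘ (k ∷_))) α) ⟩
  conv a (λ j i → conv i (λ m k → cauchy (f ∘ (j ∷_)) (cauchy (g ∘ (m ∷_)) (h ∘ (k ∷_))) α))
    ≡⟨ conv-cong a (λ j i _ → conv-cong i (λ m k _ → cauchy-comm (f ∘ (j ∷_)) (cauchy (g ∘ (m ∷_)) (h ∘ (k ∷_))) α)) ⟩
  conv a (λ j i → conv i (λ m k → cauchy (cauchy (g ∘ (m ∷_)) (h ∘ (k ∷_))) (f ∘ (j ∷_)) α))
    ≡⟨ conv-cong a (λ j i _ → cauchy-∑ˡ (suc i) (λ m → cauchy (g ∘ (m ∷_)) (h ∘ ((i ∸ m) ∷_))) (f ∘ (j ∷_)) α) ⟨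
  conv a (λ j i → cauchy (λ β → conv i (λ m k → cauchy (g ∘ (m ∷_)) (h ∘ (k ∷_)) β)) (f ∘ (j ∷_)) α)
    ≡⟨ conv-cong a (λ j i _ → cauchy-comm (λ β → conv i (λ m k → cauchy (g ∘ (m ∷_)) (h ∘ (k ∷_)) β)) (f ∘ (j ∷_)) α) ⟩
  conv a (λ j i → cauchy (f ∘ (j ∷_)) (λ β → conv i (λ m k → cauchy (g ∘ (m ∷_)) (h ∘ (k ∷_)) β)) α) ∎
  where open ≡-Reasoning

cauchy-constˡ : ∀ q g α → cauchy (coeff (const q)) g α ≡ q * g α
cauchy-constˡ q g []      = refl
cauchy-constˡ q g (a ∷ α) = trans
  (cong₂ _+_ (cauchy-constˡ q (g ∘ (a ∷_)) α) (rest a))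
  (ℚₚ.+-identityʳ _)
  where
  rest : ∀ a → ∑< a (λ i → cauchy (λ _ → 0ℚ) (λ β → g ((a ∸ suc i) ∷ β)) α) ≡ 0ℚ
  rest a = trans (∑<-cong a (λ i → cauchy-zeroˡ (λ β → g ((a ∸ suc i) ∷ β)) α)) (∑<-zero a)

-- Orders of vanishing add up under multiplication. Splitting off the exponents i and j of one
-- variable leaves the orders m - i and n - j for the remaining ones.
cauchy-vanish : ∀ m n f g α → (∀ β → degree β < m → f β ≡ 0ℚ) → (∀ β → degree β < n → g β ≡ 0ℚ) →
                degree α < m ℕ.+ n → cauchy f g α ≡ 0ℚ
cauchy-vanish zero    n f g [] f≡0 g≡0 0<n = trans (cong (f [] *_) (g≡0 [] 0<n)) (ℚₚ.*-zeroʳ (f []))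
cauchy-vanish (suc m) n f g [] f≡0 g≡0 _   = trans (cong (_* g []) (f≡0 [] (s≤s z≤n))) (ℚₚ.*-zeroˡ (g []))
cauchy-vanish m n f g (a ∷ α) f≡0 g≡0 deg<  = trans
  (conv-cong a (λ i j i+j≡a → cauchy-vanish (m ∸ i) (n ∸ j) (f ∘ (i ∷_)) (g ∘ (j ∷_)) α
    (λ β lt → f≡0 (i ∷ β) (shift i m lt))
    (λ β lt → g≡0 (j ∷ β) (shift j n lt))
    (bound i j i+j≡a)))
  (conv-zero a)
  where
  shift : ∀ i m {d} → d < m ∸ i → i ℕ.+ d < m
  shift zero    m       lt = lt
  shift (suc i) (suc m) lt = s≤s (shift i m lt)

  -- Truncated subtraction does no harm, since m ≤ i + (m ∸ i) also when i exceeds m.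
  bound : ∀ i j → i ℕ.+ j ≡ a → degree α < (m ∸ i) ℕ.+ (n ∸ j)
  bound i j refl = ℕₚ.+-cancelˡ-< (i ℕ.+ j) _ _ (ℕₚ.<-≤-trans deg< (begin
    m ℕ.+ n                             ≤⟨ ℕₚ.+-mono-≤ (ℕₚ.m≤n+m∸n m i) (ℕₚ.m≤n+m∸n n j) ⟩
    (i ℕ.+ (m ∸ i)) ℕ.+ (j ℕ.+ (n ∸ j)) ≡⟨ ℕ+-interchange i (m ∸ i) j (n ∸ j) ⟩
    (i ℕ.+ j) ℕ.+ ((m ∸ i) ℕ.+ (n ∸ j)) ∎))
    where
    open ℕₚ.≤-Reasoning
    ℕ+-interchange : ∀ a b c d → (a ℕ.+ b) ℕ.+ (c ℕ.+ d) ≡ (a ℕ.+ c) ℕ.+ (b ℕ.+ d)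
    ℕ+-interchange a b c d = trans (ℕₚ.+-assoc a b _) (trans (cong (a ℕ.+_)
      (trans (sym (ℕₚ.+-assoc b c d)) (trans (cong (ℕ._+ d) (ℕₚ.+-comm b c)) (ℕₚ.+-assoc c b d)))) (sym (ℕₚ.+-assoc a c _)))

-- Derivatives and multiplication by a variable, on coefficient functions

Padded : (Monomial → ℚ) → Set
Padded f = ∀ α → f (α ++ [ 0 ]) ≡ f α

padded-degree-zero : ∀ {f} → Padded f → ∀ α → degree α ≡ 0 → f α ≡ f []
padded-degree-zero pad []         _  = refl
padded-degree-zero pad (zero ∷ α) eq = trans (padded-degree-zero (pad ∘ (0 ∷_)) α eq) (pad [])

∂ᶜ : ℕ → (Monomial → ℚ) → Monomial → ℚ
∂ᶜ k f α = fromℕℚ (suc (exponent k α)) * f (raise k α)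

-- In the differentiated variable this is `conv-leibniz`; the other variables only contribute outer
-- convolutions. At the monomial `[]` raising lengthens the list, and padding identifies the
-- coefficients at `0 ∷ []` and `[]`.
cauchy-leibniz : ∀ k {f g} → Padded f → Padded g → ∀ α →
                 ∂ᶜ k (cauchy f g) α ≡ cauchy (∂ᶜ k f) g α + cauchy f (∂ᶜ k g) α
cauchy-leibniz zero {f} {g} pf pg [] = begin
  1ℚ * (f (0 ∷ []) * g (1 ∷ []) + (f (1 ∷ []) * g (0 ∷ []) + 0ℚ))
    ≡⟨ cong₂ (λ x y → 1ℚ * (x * g (1 ∷ []) + (f (1 ∷ []) * y + 0ℚ))) (pf []) (pg []) ⟩
  1ℚ * (f [] * g (1 ∷ []) + (f (1 ∷ []) * g [] + 0ℚ))
    ≡⟨ solve 4 (λ a b c d → con 1ℚ :* (a :* b :+ (c :* d :+ con 0ℚ)) := (con 1ℚ :* c) :* d :+ a :* (con 1ℚ :* b))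
         refl (f []) (g (1 ∷ [])) (f (1 ∷ [])) (g []) ⟩
  (1ℚ * f (1 ∷ [])) * g [] + f [] * (1ℚ * g (1 ∷ [])) ∎
  where open ≡-Reasoning
cauchy-leibniz zero {f} {g} pf pg (a ∷ α) = trans
  (conv-leibniz a (λ i j → cauchy (f ∘ (i ∷_)) (g ∘ (j ∷_)) α))
  (cong₂ _+_
    (conv-cong a (λ i j _ → sym (cauchy-*ˡ (fromℕℚ (suc i)) (f ∘ (suc i ∷_)) (g ∘ (j ∷_)) α)))
    (conv-cong a (λ i j _ → sym (cauchy-*ʳ (fromℕℚ (suc j)) (f ∘ (i ∷_)) (g ∘ (suc j ∷_)) α))))
  where
  cauchy-*ʳ : ∀ q f g α → cauchy f (λ β → q * g β) α ≡ q * cauchy f g α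
  cauchy-*ʳ q f g α = trans (cauchy-comm f _ α) (trans (cauchy-*ˡ q g f α) (cong (q *_) (cauchy-comm g f α)))
cauchy-leibniz (suc k) {f} {g} pf pg [] = begin
  1ℚ * (cauchy f₀ g₀ (raise k []) + 0ℚ)       ≡⟨ cong (1ℚ *_) (ℚₚ.+-identityʳ (cauchy f₀ g₀ (raise k []))) ⟩
  1ℚ * cauchy f₀ g₀ (raise k [])              ≡⟨ cauchy-leibniz k (pf ∘ (0 ∷_)) (pg ∘ (0 ∷_)) [] ⟩
  ∂ᶜ k f₀ [] * g₀ [] + f₀ [] * ∂ᶜ k g₀ []     ≡⟨ cong₂ (λ x y → ∂ᶜ k f₀ [] * y + x * ∂ᶜ k g₀ []) (pf []) (pg []) ⟩
  ∂ᶜ (suc k) f [] * g [] + f [] * ∂ᶜ (suc k) g [] ∎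
  where
  open ≡-Reasoning
  f₀ g₀ : Monomial → ℚ
  f₀ = f ∘ (0 ∷_)
  g₀ = g ∘ (0 ∷_)
cauchy-leibniz (suc k) {f} {g} pf pg (a ∷ α) = begin
  e * conv a (λ i j → cauchy (f ∘ (i ∷_)) (g ∘ (j ∷_)) (raise k α))
    ≡⟨ conv-* a e (λ i j → cauchy (f ∘ (i ∷_)) (g ∘ (j ∷_)) (raise k α)) ⟨
  conv a (λ i j → ∂ᶜ k (cauchy (f ∘ (i ∷_)) (g ∘ (j ∷_))) α)
    ≡⟨ conv-cong a (λ i j _ → cauchy-leibniz k (pf ∘ (i ∷_)) (pg ∘ (j ∷_)) α) ⟩
  conv a (λ i j → cauchy (∂ᶜ k (f ∘ (i ∷_))) (g ∘ (j ∷_)) α + cauchy (f ∘ (i ∷_)) (∂ᶜ k (g ∘ (j ∷_))) α)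
    ≡⟨ conv-+ a (λ i j → cauchy (∂ᶜ k (f ∘ (i ∷_))) (g ∘ (j ∷_)) α) (λ i j → cauchy (f ∘ (i ∷_)) (∂ᶜ k (g ∘ (j ∷_))) α) ⟩
  cauchy (∂ᶜ (suc k) f) g (a ∷ α) + cauchy f (∂ᶜ (suc k) g) (a ∷ α) ∎
  where
  open ≡-Reasoning
  e = fromℕℚ (suc (exponent k α))

xᶜ : ℕ → (Monomial → ℚ) → Monomial → ℚ
xᶜ ℓ f α = maybe′ f 0ℚ (lower ℓ α)

maybe-map : ∀ (f : Monomial → ℚ) a m → maybe′ f 0ℚ (mapᴹ (a ∷_) m) ≡ maybe′ (f ∘ (a ∷_)) 0ℚ m
maybe-map f a (just _) = refl
maybe-map f a nothing  = refl

cauchy-xˡ : ∀ ℓ f g α → cauchy (xᶜ ℓ f) g α ≡ xᶜ ℓ (cauchy f g) α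
cauchy-xˡ zero    f g [] = ℚₚ.*-zeroˡ (g [])
cauchy-xˡ (suc ℓ) f g [] = ℚₚ.*-zeroˡ (g [])
cauchy-xˡ zero f g (zero ∷ α)  = trans (ℚₚ.+-identityʳ _) (cauchy-zeroˡ (g ∘ (0 ∷_)) α)
cauchy-xˡ zero f g (suc a ∷ α) = trans (cong (_+ cauchy f g (a ∷ α)) (cauchy-zeroˡ (g ∘ (suc a ∷_)) α)) (ℚₚ.+-identityˡ _)
cauchy-xˡ (suc ℓ) f g (a ∷ α)  = begin
  conv a (λ i j → cauchy (λ β → maybe′ f 0ℚ (mapᴹ (i ∷_) (lower ℓ β))) (g ∘ (j ∷_)) α)
    ≡⟨ conv-cong a (λ i j _ → cauchy-cong-≗ α {g = g ∘ (j ∷_)} (λ β → maybe-map f i (lower ℓ β)) (λ _ → refl)) ⟩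
  conv a (λ i j → cauchy (xᶜ ℓ (f ∘ (i ∷_))) (g ∘ (j ∷_)) α)
    ≡⟨ conv-cong a (λ i j _ → cauchy-xˡ ℓ (f ∘ (i ∷_)) (g ∘ (j ∷_)) α) ⟩
  conv a (λ i j → maybe′ (cauchy (f ∘ (i ∷_)) (g ∘ (j ∷_))) 0ℚ (lower ℓ α))
    ≡⟨ conv-maybe (lower ℓ α) ⟩
  maybe′ (cauchy f g ∘ (a ∷_)) 0ℚ (lower ℓ α)
    ≡⟨ maybe-map (cauchy f g) a (lower ℓ α) ⟨
  maybe′ (cauchy f g) 0ℚ (mapᴹ (a ∷_) (lower ℓ α)) ∎
  where
  open ≡-Reasoning
  conv-maybe : ∀ m → conv a (λ i j → maybe′ (cauchy (f ∘ (i ∷_)) (g ∘ (j ∷_))) 0ℚ m) ≡ maybe′ (cauchy f g ∘ (a ∷_)) 0ℚ m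
  conv-maybe (just β) = refl
  conv-maybe nothing  = conv-zero a

-- The ring of power series

infix 4 _≋_ _≋[_]_

-- A record rather than `≈` itself, so that the two series can be recovered from the type of a
-- proof.
record _≋_ (f g : PowerSeries) : Set where
  constructor mk
  field at : f ≈ g
open _≋_

-- Congruence modulo terms of degree at least N: the topology in which a substitution is the limit
-- of its partial sums.
record _≋[_]_ (f : PowerSeries) (N : ℕ) (g : PowerSeries) : Set where
  constructor mk
  field at< : ∀ α → degree α < N → coeff f α ≡ coeff g α
open _≋[_]_

≋-setoid : Setoid 0ℓ 0ℓ
≋-setoid = record
  { Carrier = PowerSeries ; _≈_ = _≋_
  ; isEquivalence = record
    { refl  = mk λ _ → refl
    ; sym   = λ p → mk λ α → sym (at p α)
    ; trans = λ p q → mk λ α → trans (at p α) (at q α)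
    } }

≋[_]-setoid : ℕ → Setoid 0ℓ 0ℓ
≋[ N ]-setoid = record
  { Carrier = PowerSeries ; _≈_ = _≋[ N ]_
  ; isEquivalence = record
    { refl  = mk λ _ _ → refl
    ; sym   = λ p → mk λ α lt → sym (at< p α lt)
    ; trans = λ p q → mk λ α lt → trans (at< p α lt) (at< q α lt)
    } }

open Setoid ≋-setoid using () renaming (refl to ≋-refl; sym to ≋-sym; trans to ≋-trans)

truncate : ∀ {N f g} → f ≋ g → f ≋[ N ] g
truncate p = mk λ α _ → at p α

untruncate : ∀ {f g} → (∀ N → f ≋[ N ] g) → f ≋ g
untruncate p = mk λ α → at< (p (suc (degree α))) α ℕₚ.≤-refl

𝟎 𝟏 : PowerSeries
𝟎 = const 0ℚ
𝟏 = const (fromℕℚ 1)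

coeff-𝟎 : ∀ α → coeff 𝟎 α ≡ 0ℚ
coeff-𝟎 []          = refl
coeff-𝟎 (zero  ∷ α) = coeff-𝟎 α
coeff-𝟎 (suc _ ∷ α) = refl

⊕-cong : ∀ {f f′ g g′} → f ≋ f′ → g ≋ g′ → f ⊕ g ≋ f′ ⊕ g′
⊕-cong p q = mk λ α → cong₂ _+_ (at p α) (at q α)

·-cong : ∀ q {f f′} → f ≋ f′ → q · f ≋ q · f′
·-cong q p = mk λ α → cong (q *_) (at p α)

⊕-cong< : ∀ {N f f′ g g′} → f ≋[ N ] f′ → g ≋[ N ] g′ → f ⊕ g ≋[ N ] f′ ⊕ g′
⊕-cong< p q = mk λ α lt → cong₂ _+_ (at< p α lt) (at< q α lt)

⊗-cong< : ∀ {N f f′ g g′} → f ≋[ N ] f′ → g ≋[ N ] g′ → f ⊗ g ≋[ N ] f′ ⊗ g′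
⊗-cong< p q = mk λ α lt → cauchy-cong α
  (λ β _ le → at< p β (ℕₚ.≤-<-trans le lt)) (λ β _ le → at< q β (ℕₚ.≤-<-trans le lt))

⊗-cong : ∀ {f f′ g g′} → f ≋ f′ → g ≋ g′ → f ⊗ g ≋ f′ ⊗ g′
⊗-cong p q = mk λ α → cauchy-cong-≗ α (at p) (at q)

⊗-comm : ∀ f g → f ⊗ g ≋ g ⊗ f
⊗-comm f g = mk (cauchy-comm (coeff f) (coeff g))

⊗-assoc : ∀ f g h → (f ⊗ g) ⊗ h ≋ f ⊗ (g ⊗ h)
⊗-assoc f g h = mk (cauchy-assoc (coeff f) (coeff g) (coeff h))

⊗-distribʳ-⊕ : ∀ h f g → (f ⊕ g) ⊗ h ≋ (f ⊗ h) ⊕ (g ⊗ h)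
⊗-distribʳ-⊕ h f g = mk (cauchy-+ˡ (coeff f) (coeff g) (coeff h))

⊗-distribˡ-⊕ : ∀ h f g → h ⊗ (f ⊕ g) ≋ (h ⊗ f) ⊕ (h ⊗ g)
⊗-distribˡ-⊕ h f g = ≋-trans (⊗-comm h (f ⊕ g)) (≋-trans (⊗-distribʳ-⊕ h f g) (⊕-cong (⊗-comm f h) (⊗-comm g h)))

·-⊗-assoc : ∀ q f g → (q · f) ⊗ g ≋ q · (f ⊗ g)
·-⊗-assoc q f g = mk (cauchy-*ˡ q (coeff f) (coeff g))

⊗-·-comm : ∀ q f g → f ⊗ (q · g) ≋ q · (f ⊗ g)
⊗-·-comm q f g = ≋-trans (⊗-comm f (q · g)) (≋-trans (·-⊗-assoc q g f) (·-cong q (⊗-comm g f)))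

⊗-identityˡ : ∀ f → 𝟏 ⊗ f ≋ f
⊗-identityˡ f = mk λ α → trans (cauchy-constˡ (fromℕℚ 1) (coeff f) α) (ℚₚ.*-identityˡ (coeff f α))

⊗-identityʳ : ∀ f → f ⊗ 𝟏 ≋ f
⊗-identityʳ f = ≋-trans (⊗-comm f 𝟏) (⊗-identityˡ f)

⊗-zeroʳ : ∀ f → f ⊗ 𝟎 ≋ 𝟎
⊗-zeroʳ f = ≋-trans (⊗-comm f 𝟎) (mk λ α → trans (cauchy-constˡ 0ℚ (coeff f) α) (trans (ℚₚ.*-zeroˡ (coeff f α)) (sym (coeff-𝟎 α))))

sumPS-cong : ∀ n {G H} → (∀ i → G i ≋ H i) → sumPS n G ≋ sumPS n H
sumPS-cong n p = mk λ α → ∑<-cong n (λ i → at (p i) α)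

sumPS-⊕ : ∀ n G H → sumPS n (λ i → G i ⊕ H i) ≋ sumPS n G ⊕ sumPS n H
sumPS-⊕ n G H = mk λ α → ∑<-+ n (λ i → coeff (G i) α) (λ i → coeff (H i) α)

sumPS-· : ∀ n q G → sumPS n (λ i → q · G i) ≋ q · sumPS n G
sumPS-· n q G = mk λ α → ∑<-* n q (λ i → coeff (G i) α)

sumPS-⊗ : ∀ n G h → sumPS n G ⊗ h ≋ sumPS n (λ i → G i ⊗ h)
sumPS-⊗ n G h = mk (cauchy-∑ˡ n (coeff ∘ G) (coeff h))

-- Cancellation of units: w v = 0 gives v = (1 - w) v, and 1 - w has no constant
-- term, so the order of vanishing of v can be increased indefinitely.
⊗-cancel-unit : ∀ w v → coeff w [] ≡ 1ℚ → w ⊗ v ≋ 𝟎 → v ≋ 𝟎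
⊗-cancel-unit w v w₀ wv≋𝟎 = mk λ α → trans (vanish (suc (degree α)) α ℕₚ.≤-refl) (sym (coeff-𝟎 α))
  where
  n : PowerSeries
  n = 𝟏 ⊖ w

  n-vanish : ∀ β → degree β < 1 → coeff n β ≡ 0ℚ
  n-vanish β (s≤s le) = trans (padded-degree-zero (coeff-pad n) β (ℕₚ.n≤0⇒n≡0 le)) (cong (_-_ 1ℚ) w₀)

  v≡nv : ∀ α → coeff v α ≡ coeff (n ⊗ v) α
  v≡nv α = begin
    v′                     ≡⟨ solve 1 (λ v → v := v :- con 0ℚ) refl v′ ⟩
    v′ - 0ℚ                ≡⟨ cong (_-_ v′) (trans (at wv≋𝟎 α) (coeff-𝟎 α)) ⟨
    v′ - coeff (w ⊗ v) α   ≡⟨ solve 2 (λ x y → x :- y := x :+ con (- 1ℚ) :* y) refl v′ (coeff (w ⊗ v) α) ⟩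
    v′ + - 1ℚ * coeff (w ⊗ v) α ≡⟨ cong₂ _+_ (at (⊗-identityˡ v) α) (at (·-⊗-assoc (- 1ℚ) w v) α) ⟨
    coeff (𝟏 ⊗ v) α + coeff ((- 1ℚ · w) ⊗ v) α ≡⟨ at (⊗-distribʳ-⊕ v 𝟏 (- 1ℚ · w)) α ⟨
    coeff ((𝟏 ⊕ - 1ℚ · w) ⊗ v) α ≡⟨ cauchy-cong-≗ α {g = coeff v} (λ β → solve 2 (λ x y → x :+ con (- 1ℚ) :* y := x :- y) refl (coeff 𝟏 β) (coeff w β)) (λ _ → refl) ⟩
    coeff (n ⊗ v) α ∎
    where
    open ≡-Reasoning
    v′ = coeff v α

  vanish : ∀ N α → degree α < N → coeff v α ≡ 0ℚ
  vanish (suc N) α lt = trans (v≡nv α) (cauchy-vanish 1 N (coeff n) (coeff v) α n-vanish (vanish N) lt)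

-- Derivations

-- `local` is continuity with a loss of one degree. It allows D to be applied to a substitution by
-- way of its partial sums, and it makes D respect equality.
record Derivation (D : PowerSeries → PowerSeries) : Set where
  field
    local   : ∀ {N f g} → f ≋[ suc N ] g → D f ≋[ N ] D g
    homo-⊕  : ∀ f g → D (f ⊕ g) ≋ D f ⊕ D g
    homo-·  : ∀ q f → D (q · f) ≋ q · D f
    leibniz : ∀ f g → D (f ⊗ g) ≋ (D f ⊗ g) ⊕ (f ⊗ D g)

  D-cong : ∀ {f g} → f ≋ g → D f ≋ D g
  D-cong p = untruncate λ N → local (truncate p)

  homo-sumPS : ∀ n G → D (sumPS n G) ≋ sumPS n (D ∘ G)
  homo-sumPS zero    G = begin
    -- The empty sum is written as a multiple by 0, so that homogeneity shows that D kills it.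
    D (sumPS 0 G)        ≈⟨ D-cong (mk λ α → sym (ℚₚ.*-zeroˡ (coeff (G 0) α))) ⟩
    D (0ℚ · G 0)         ≈⟨ homo-· 0ℚ (G 0) ⟩
    0ℚ · D (G 0)         ≈⟨ mk (λ α → ℚₚ.*-zeroˡ (coeff (D (G 0)) α)) ⟩
    sumPS 0 (D ∘ G)      ∎
    where open SetoidReasoning ≋-setoid
  homo-sumPS (suc n) G = begin
    D (sumPS (suc n) G)              ≈⟨ D-cong (mk λ _ → refl) ⟩
    D (G 0 ⊕ sumPS n (G ∘ suc))      ≈⟨ homo-⊕ (G 0) (sumPS n (G ∘ suc)) ⟩
    D (G 0) ⊕ D (sumPS n (G ∘ suc))  ≈⟨ ⊕-cong ≋-refl (homo-sumPS n (G ∘ suc)) ⟩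
    D (G 0) ⊕ sumPS n (D ∘ G ∘ suc)  ≈⟨ mk (λ _ → refl) ⟩
    sumPS (suc n) (D ∘ G)            ∎
    where open SetoidReasoning ≋-setoid

  D-𝟏 : D 𝟏 ≋ 𝟎
  D-𝟏 = mk λ α → trans (zero-of-double (at D𝟏+D𝟏 α)) (sym (coeff-𝟎 α))
    where
    D𝟏+D𝟏 : D 𝟏 ≋ D 𝟏 ⊕ D 𝟏
    D𝟏+D𝟏 = begin
      D 𝟏                       ≈⟨ D-cong (⊗-identityˡ 𝟏) ⟨
      D (𝟏 ⊗ 𝟏)                 ≈⟨ leibniz 𝟏 𝟏 ⟩
      (D 𝟏 ⊗ 𝟏) ⊕ (𝟏 ⊗ D 𝟏)     ≈⟨ ⊕-cong (⊗-identityʳ (D 𝟏)) (⊗-identityˡ (D 𝟏)) ⟩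
      D 𝟏 ⊕ D 𝟏                 ∎
      where open SetoidReasoning ≋-setoid
    zero-of-double : ∀ {x} → x ≡ x + x → x ≡ 0ℚ
    zero-of-double {x} eq = trans (solve 1 (λ x → x := (x :+ x) :- x) refl x)
                                  (trans (cong (_- x) (sym eq)) (ℚₚ.+-inverseʳ x))

  power-rule : ∀ R n → D (R ↑ suc n) ≋ fromℕℚ (suc n) · ((R ↑ n) ⊗ D R)
  power-rule R zero    = begin
    D (R ⊗ 𝟏)             ≈⟨ D-cong (⊗-identityʳ R) ⟩
    D R                   ≈⟨ ⊗-identityˡ (D R) ⟨
    𝟏 ⊗ D R               ≈⟨ mk (λ α → sym (ℚₚ.*-identityˡ (coeff (𝟏 ⊗ D R) α))) ⟩
    fromℕℚ 1 · (𝟏 ⊗ D R)  ∎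
    where open SetoidReasoning ≋-setoid
  power-rule R (suc n) = begin
    D (R ⊗ (R ↑ suc n))
      ≈⟨ leibniz R (R ↑ suc n) ⟩
    (D R ⊗ (R ↑ suc n)) ⊕ (R ⊗ D (R ↑ suc n))
      ≈⟨ ⊕-cong (⊗-comm (D R) (R ↑ suc n)) (⊗-cong ≋-refl (power-rule R n)) ⟩
    ((R ↑ suc n) ⊗ D R) ⊕ (R ⊗ (s · ((R ↑ n) ⊗ D R)))
      ≈⟨ ⊕-cong ≋-refl (≋-trans (⊗-·-comm s R ((R ↑ n) ⊗ D R)) (·-cong s (≋-sym (⊗-assoc R (R ↑ n) (D R))))) ⟩
    ((R ↑ suc n) ⊗ D R) ⊕ (s · ((R ↑ suc n) ⊗ D R))
      ≈⟨ mk (λ α → trans (solve 2 (λ s x → x :+ s :* x := (con 1ℚ :+ s) :* x) refl s (coeff ((R ↑ suc n) ⊗ D R) α))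
                         (cong (_* coeff ((R ↑ suc n) ⊗ D R) α) (sym (fromℕℚ-suc (suc n))))) ⟩
    fromℕℚ (suc (suc n)) · ((R ↑ suc n) ⊗ D R) ∎
    where
    open SetoidReasoning ≋-setoid
    s = fromℕℚ (suc n)

open Derivation

degree-raise : ∀ k α → degree (raise k α) ≡ suc (degree α)
degree-raise zero    []      = refl
degree-raise (suc k) []      = degree-raise k []
degree-raise zero    (a ∷ α) = refl
degree-raise (suc k) (a ∷ α) = trans (cong (a ℕ.+_) (degree-raise k α)) (ℕₚ.+-suc a (degree α))

∂-derivation : ∀ k → Derivation (∂ k)
∂-derivation k = record
  { local   = λ p → mk λ α lt → cong (fromℕℚ (suc (exponent k α)) *_)
                (at< p (raise k α) (subst (_< _) (sym (degree-raise k α)) (s≤s lt)))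
  ; homo-⊕  = λ f g → mk λ α → ℚₚ.*-distribˡ-+ (fromℕℚ (suc (exponent k α))) (coeff f (raise k α)) (coeff g (raise k α))
  ; homo-·  = λ q f → mk λ α → solve 3 (λ e q x → e :* (q :* x) := q :* (e :* x)) refl
                (fromℕℚ (suc (exponent k α))) q (coeff f (raise k α))
  ; leibniz = λ f g → mk (cauchy-leibniz k (coeff-pad f) (coeff-pad g))
  }

⊕-derivation : ∀ {D E} → Derivation D → Derivation E → Derivation (λ f → D f ⊕ E f)
⊕-derivation {D} {E} d e = record
  { local   = λ p → ⊕-cong< (local d p) (local e p)
  ; homo-⊕  = λ f g → mk λ α → trans (cong₂ _+_ (at (homo-⊕ d f g) α) (at (homo-⊕ e f g) α))
                (interchange (coeff (D f) α) (coeff (D g) α) (coeff (E f) α) (coeff (E g) α))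
  ; homo-·  = λ q f → mk λ α → trans (cong₂ _+_ (at (homo-· d q f) α) (at (homo-· e q f) α))
                (sym (ℚₚ.*-distribˡ-+ q (coeff (D f) α) (coeff (E f) α)))
  ; leibniz = λ f g → ≋-trans (⊕-cong (leibniz d f g) (leibniz e f g))
                (≋-trans (mk λ α → interchange (coeff (D f ⊗ g) α) (coeff (f ⊗ D g) α) (coeff (E f ⊗ g) α) (coeff (f ⊗ E g) α))
                  (⊕-cong (≋-sym (⊗-distribʳ-⊕ g (D f) (E f))) (≋-sym (⊗-distribˡ-⊕ f (D g) (E g)))))
  }

·-derivation : ∀ {D} q → Derivation D → Derivation (λ f → q · D f)
·-derivation {D} q d = record
  { local   = λ p → mk λ α lt → cong (q *_) (at< (local d p) α lt)
  ; homo-⊕  = λ f g → mk λ α → trans (cong (q *_) (at (homo-⊕ d f g) α)) (ℚₚ.*-distribˡ-+ q (coeff (D f) α) (coeff (D g) α))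
  ; homo-·  = λ c f → mk λ α → trans (cong (q *_) (at (homo-· d c f) α))
                (solve 3 (λ q c x → q :* (c :* x) := c :* (q :* x)) refl q c (coeff (D f) α))
  ; leibniz = λ f g → ≋-trans (·-cong q (leibniz d f g))
                (≋-trans (mk λ α → ℚₚ.*-distribˡ-+ q (coeff (D f ⊗ g) α) (coeff (f ⊗ D g) α))
                  (⊕-cong (≋-sym (·-⊗-assoc q (D f) g)) (≋-sym (⊗-·-comm q f (D g)))))
  }

derivation-resp-≋ : ∀ {D E} → (∀ f → D f ≋ E f) → Derivation D → Derivation E
derivation-resp-≋ {D} {E} D≋E d = record
  { local   = λ {N} {f} {g} p → mk λ α lt → trans (sym (at (D≋E f) α)) (trans (at< (local d p) α lt) (at (D≋E g) α))
  ; homo-⊕  = λ f g → ≋-trans (≋-sym (D≋E (f ⊕ g))) (≋-trans (homo-⊕ d f g) (⊕-cong (D≋E f) (D≋E g)))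
  ; homo-·  = λ q f → ≋-trans (≋-sym (D≋E (q · f))) (≋-trans (homo-· d q f) (·-cong q (D≋E f)))
  ; leibniz = λ f g → ≋-trans (≋-sym (D≋E (f ⊗ g))) (≋-trans (leibniz d f g)
                (⊕-cong (⊗-cong (D≋E f) ≋-refl) (⊗-cong ≋-refl (D≋E g))))
  }

neg-≋ : ∀ f → - 1ℚ · f ≋ neg f
neg-≋ f = mk λ α → solve 1 (λ x → con (- 1ℚ) :* x := :- x) refl (coeff f α)

neg-derivation : ∀ {D} → Derivation D → Derivation (λ f → neg (D f))
neg-derivation {D} d = derivation-resp-≋ (λ f → neg-≋ (D f)) (·-derivation (- 1ℚ) d)

⊖-derivation : ∀ {D E} → Derivation D → Derivation E → Derivation (λ f → D f ⊖ E f)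
⊖-derivation d e = ⊕-derivation d (neg-derivation e)

sumPS-derivation : ∀ n {D : ℕ → PowerSeries → PowerSeries} → (∀ i → Derivation (D i)) →
                   Derivation (λ f → sumPS n (λ i → D i f))
sumPS-derivation n {D} d = record
  { local   = λ p → mk λ α lt → ∑<-cong n (λ i → at< (local (d i) p) α lt)
  ; homo-⊕  = λ f g → ≋-trans (sumPS-cong n (λ i → homo-⊕ (d i) f g)) (sumPS-⊕ n (λ i → D i f) (λ i → D i g))
  ; homo-·  = λ q f → ≋-trans (sumPS-cong n (λ i → homo-· (d i) q f)) (sumPS-· n q (λ i → D i f))
  ; leibniz = λ f g → ≋-trans (sumPS-cong n (λ i → leibniz (d i) f g))
                (≋-trans (sumPS-⊕ n (λ i → D i f ⊗ g) (λ i → f ⊗ D i g))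
                  (⊕-cong (≋-sym (sumPS-⊗ n (λ i → D i f) g))
                          (≋-trans (sumPS-cong n (λ i → ⊗-comm f (D i g)))
                            (≋-trans (≋-sym (sumPS-⊗ n (λ i → D i g) f)) (⊗-comm (sumPS n (λ i → D i g)) f)))))
  }

degree-lower : ∀ ℓ α {β} → lower ℓ α ≡ just β → degree β < degree α
degree-lower zero    (suc a ∷ α) refl = ℕₚ.≤-refl
degree-lower (suc ℓ) (a ∷ α) eq with lower ℓ α in eq′
degree-lower (suc ℓ) (a ∷ α) refl | just β = ℕₚ.+-monoʳ-< a (degree-lower ℓ α eq′)

x-cong : ∀ ℓ α {f g : Monomial → ℚ} → (∀ β → degree β < degree α → f β ≡ g β) → xᶜ ℓ f α ≡ xᶜ ℓ g α
x-cong ℓ α f≡g with lower ℓ α in eq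
... | just β  = f≡g β (degree-lower ℓ α eq)
... | nothing = refl

∑x-cong : ∀ {G H} → (∀ ℓ → G ℓ ≋ H ℓ) → ∑x G ≋ ∑x H
∑x-cong p = mk λ α → ∑<-cong (length α) (λ ℓ → x-cong ℓ α (λ β _ → at (p ℓ) β))

x-+ : ∀ ℓ α f g → xᶜ ℓ (λ β → f β + g β) α ≡ xᶜ ℓ f α + xᶜ ℓ g α
x-+ ℓ α f g with lower ℓ α
... | just β  = refl
... | nothing = refl

x-* : ∀ ℓ α q f → xᶜ ℓ (λ β → q * f β) α ≡ q * xᶜ ℓ f α
x-* ℓ α q f with lower ℓ α
... | just β  = refl
... | nothing = sym (ℚₚ.*-zeroʳ q)

∑x-⊕ : ∀ G H → ∑x (λ ℓ → G ℓ ⊕ H ℓ) ≋ ∑x G ⊕ ∑x H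
∑x-⊕ G H = mk λ α → trans (∑<-cong (length α) (λ ℓ → x-+ ℓ α (coeff (G ℓ)) (coeff (H ℓ))))
  (∑<-+ (length α) (λ ℓ → xᶜ ℓ (coeff (G ℓ)) α) (λ ℓ → xᶜ ℓ (coeff (H ℓ)) α))

∑x-· : ∀ q G → ∑x (λ ℓ → q · G ℓ) ≋ q · ∑x G
∑x-· q G = mk λ α → trans (∑<-cong (length α) (λ ℓ → x-* ℓ α q (coeff (G ℓ))))
  (∑<-* (length α) q (λ ℓ → xᶜ ℓ (coeff (G ℓ)) α))

-- The sum over ℓ has a range depending on the monomial, but the product at α involves only
-- monomials of the length of α, so one finite range serves throughout.
∑x-⊗ : ∀ G h → ∑x G ⊗ h ≋ ∑x (λ ℓ → G ℓ ⊗ h)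
∑x-⊗ G h = mk λ α → trans
  (cauchy-cong α {g = coeff h} (λ β len _ → cong (λ n → ∑< n (λ ℓ → xᶜ ℓ (coeff (G ℓ)) β)) len) (λ _ _ _ → refl))
  (trans (cauchy-∑ˡ (length α) (λ ℓ → xᶜ ℓ (coeff (G ℓ))) (coeff h) α)
         (∑<-cong (length α) (λ ℓ → cauchy-xˡ ℓ (coeff (G ℓ)) (coeff h) α)))

-- At each monomial only finitely many ℓ occur, and division by x̂_ℓ lowers the degree, so the
-- infinite sum keeps the required locality.
∑x-derivation : ∀ {D : ℕ → PowerSeries → PowerSeries} → (∀ ℓ → Derivation (D ℓ)) →
                Derivation (λ f → ∑x (λ ℓ → D ℓ f))
∑x-derivation {D} d = record
  { local   = λ p → mk λ α lt → ∑<-cong (length α) (λ ℓ → x-cong ℓ α (λ β lt′ → at< (local (d ℓ) p) β (ℕₚ.<-trans lt′ lt)))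
  ; homo-⊕  = λ f g → ≋-trans (∑x-cong (λ ℓ → homo-⊕ (d ℓ) f g)) (∑x-⊕ (λ ℓ → D ℓ f) (λ ℓ → D ℓ g))
  ; homo-·  = λ q f → ≋-trans (∑x-cong (λ ℓ → homo-· (d ℓ) q f)) (∑x-· q (λ ℓ → D ℓ f))
  ; leibniz = λ f g → ≋-trans (∑x-cong (λ ℓ → leibniz (d ℓ) f g))
                (≋-trans (∑x-⊕ (λ ℓ → D ℓ f ⊗ g) (λ ℓ → f ⊗ D ℓ g))
                  (⊕-cong (≋-sym (∑x-⊗ (λ ℓ → D ℓ f) g))
                          (≋-trans (∑x-cong (λ ℓ → ⊗-comm f (D ℓ g)))
                            (≋-trans (≋-sym (∑x-⊗ (λ ℓ → D ℓ g) f)) (⊗-comm (∑x (λ ℓ → D ℓ g)) f)))))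
  }

Dˢᵗʳ-derivation : ∀ b → Derivation (Dˢᵗʳ b)
Dˢᵗʳ-derivation b = ⊖-derivation (∂-derivation 1) (∑x-derivation λ ℓ →
  ⊖-derivation (⊕-derivation (neg-derivation (·-derivation (fromℕℚ ℓ) (∂-derivation ℓ))) (∑2k∂-derivation ℓ))
               (∑2k∂-derivation b))
  where
  ∑2k∂-derivation : ∀ n → Derivation (∑2k∂ n)
  ∑2k∂-derivation n = sumPS-derivation n (λ i → ·-derivation (fromℕℚ (2 ℕ.* suc i)) (∂-derivation (suc i)))

Dᵈⁱˡ-derivation : Derivation Dᵈⁱˡ
Dᵈⁱˡ-derivation = ⊖-derivation (⊖-derivation (∂-derivation 1) (∂-derivation 0)) (∑x-derivation ∂-derivation)

-- Substitution and the chain rule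

∑<-extend : ∀ {m n} t → m ≤ n → (∀ i → m ≤ i → t i ≡ 0ℚ) → ∑< m t ≡ ∑< n t
∑<-extend {m} t m≤n t≡0 = go (ℕₚ.≤⇒≤′ m≤n)
  where
  go : ∀ {n} → m ℕ.≤′ n → ∑< m t ≡ ∑< n t
  go ℕ.≤′-refl = refl
  go (ℕ.≤′-step {n} m≤′n) = begin
    ∑< m t        ≡⟨ go m≤′n ⟩
    ∑< n t        ≡⟨ ℚₚ.+-identityʳ (∑< n t) ⟨
    ∑< n t + 0ℚ   ≡⟨ cong (_+_ (∑< n t)) (t≡0 n (ℕₚ.≤′⇒≤ m≤′n)) ⟨
    ∑< n t + t n  ≡⟨ ∑<-last n t ⟨
    ∑< (suc n) t  ∎
    where open ≡-Reasoning

∣r=-cong : ∀ R {F G : Series} → (∀ n → F n ≋ G n) → (F ∣r= R) ≋ (G ∣r= R)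
∣r=-cong R p = mk λ α → ∑<-cong (suc (degree α)) (λ n → at (⊗-cong (p n) (≋-refl {R ↑ n})) α)

∣r=-⊕ : ∀ R F G → ((λ n → F n ⊕ G n) ∣r= R) ≋ (F ∣r= R) ⊕ (G ∣r= R)
∣r=-⊕ R F G = mk λ α → trans
  (∑<-cong (suc (degree α)) (λ n → at (⊗-distribʳ-⊕ (R ↑ n) (F n) (G n)) α))
  (∑<-+ (suc (degree α)) (λ n → coeff (F n ⊗ R ↑ n) α) (λ n → coeff (G n ⊗ R ↑ n) α))

∣r=-· : ∀ R q F → ((λ n → q · F n) ∣r= R) ≋ q · (F ∣r= R)
∣r=-· R q F = mk λ α → trans
  (∑<-cong (suc (degree α)) (λ n → at (·-⊗-assoc q (F n) (R ↑ n)) α))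
  (∑<-* (suc (degree α)) q (λ n → coeff (F n ⊗ R ↑ n) α))

partialSum : ℕ → Series → PowerSeries → PowerSeries
partialSum N F R = sumPS N (λ n → F n ⊗ R ↑ n)

module Substitution (R : PowerSeries) (R₀ : coeff R [] ≡ 0ℚ) where

  ↑-vanish : ∀ n β → degree β < n → coeff (R ↑ n) β ≡ 0ℚ
  ↑-vanish (suc n) β lt = cauchy-vanish 1 n (coeff R) (coeff (R ↑ n)) β
    (λ γ → λ { (s≤s le) → trans (padded-degree-zero (coeff-pad R) γ (ℕₚ.n≤0⇒n≡0 le)) R₀ }) (↑-vanish n) lt

  -- R^n has no terms of degree below n, so the summands with n ≥ N are invisible below degree N.
  -- The length M is left free because N and N+1 terms are later compared at the same precision.
  ∣r=-partialSum : ∀ F {N M} → N ≤ M → (F ∣r= R) ≋[ N ] partialSum M F R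
  ∣r=-partialSum F N≤M = mk λ α lt → ∑<-extend (λ n → coeff (F n ⊗ R ↑ n) α) (ℕₚ.≤-trans lt N≤M)
    (λ n le → cauchy-vanish 0 n (coeff (F n)) (coeff (R ↑ n)) α (λ _ ()) (↑-vanish n) le)

  ∣r=-[1+r]· : ∀ F → (([1+r]· F) ∣r= R) ≋ (F ∣r= R) ⊗ (𝟏 ⊕ R)
  ∣r=-[1+r]· F = untruncate λ N → let open SetoidReasoning ≋[ N ]-setoid in begin
    ([1+r]· F) ∣r= R
      ≈⟨ ∣r=-partialSum ([1+r]· F) (ℕₚ.n≤1+n N) ⟩
    partialSum (suc N) ([1+r]· F) R
      ≈⟨ truncate (partial N) ⟩
    partialSum (suc N) F R ⊕ (partialSum N F R ⊗ R)
      ≈⟨ ⊕-cong< (∣r=-partialSum F (ℕₚ.n≤1+n N)) (⊗-cong< (∣r=-partialSum F ℕₚ.≤-refl) (truncate ≋-refl)) ⟨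
    (F ∣r= R) ⊕ ((F ∣r= R) ⊗ R)
      ≈⟨ truncate (⊕-cong (⊗-identityʳ (F ∣r= R)) ≋-refl) ⟨
    ((F ∣r= R) ⊗ 𝟏) ⊕ ((F ∣r= R) ⊗ R)
      ≈⟨ truncate (⊗-distribˡ-⊕ (F ∣r= R) 𝟏 R) ⟨
    (F ∣r= R) ⊗ (𝟏 ⊕ R) ∎
    where
    -- The product with r shifts the index, so the part multiplied by R has one term fewer.
    partial : ∀ N → partialSum (suc N) ([1+r]· F) R ≋ partialSum (suc N) F R ⊕ (partialSum N F R ⊗ R)
    partial N = begin
      partialSum (suc N) ([1+r]· F) R
        ≈⟨ mk (λ _ → refl) ⟩
      F 0 ⊗ 𝟏 ⊕ sumPS N (λ n → (F (suc n) ⊕ F n) ⊗ R ↑ suc n)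
        ≈⟨ ⊕-cong ≋-refl (≋-trans (sumPS-cong N (λ n → ⊗-distribʳ-⊕ (R ↑ suc n) (F (suc n)) (F n)))
             (sumPS-⊕ N (λ n → F (suc n) ⊗ R ↑ suc n) (λ n → F n ⊗ R ↑ suc n))) ⟩
      F 0 ⊗ 𝟏 ⊕ (sumPS N (λ n → F (suc n) ⊗ R ↑ suc n) ⊕ sumPS N (λ n → F n ⊗ R ↑ suc n))
        ≈⟨ mk (λ α → sym (ℚₚ.+-assoc (coeff (F 0 ⊗ 𝟏) α) (coeff (sumPS N (λ n → F (suc n) ⊗ R ↑ suc n)) α)
                                      (coeff (sumPS N (λ n → F n ⊗ R ↑ suc n)) α))) ⟩
      partialSum (suc N) F R ⊕ sumPS N (λ n → F n ⊗ R ↑ suc n)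
        ≈⟨ ⊕-cong ≋-refl (≋-trans (sumPS-cong N (λ n →
             ≋-trans (⊗-cong ≋-refl (⊗-comm R (R ↑ n))) (≋-sym (⊗-assoc (F n) (R ↑ n) R))))
             (≋-sym (sumPS-⊗ N (λ n → F n ⊗ R ↑ n) R))) ⟩
      partialSum (suc N) F R ⊕ (partialSum N F R ⊗ R) ∎
      where open SetoidReasoning ≋-setoid

  chain-rule : ∀ {D} → Derivation D → ∀ F →
               D (F ∣r= R) ≋ ((λ n → D (F n)) ∣r= R) ⊕ ((∂r F ∣r= R) ⊗ D R)
  chain-rule {D} d F = untruncate λ N → let open SetoidReasoning ≋[ N ]-setoid in begin
    D (F ∣r= R)
      -- Precision N+1 is used here because D loses one degree.
      ≈⟨ local d (∣r=-partialSum F ℕₚ.≤-refl) ⟩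
    D (partialSum (suc N) F R)
      ≈⟨ truncate (partial N) ⟩
    partialSum (suc N) (D ∘ F) R ⊕ (partialSum N (∂r F) R ⊗ D R)
      ≈⟨ ⊕-cong< (∣r=-partialSum (D ∘ F) (ℕₚ.n≤1+n N)) (⊗-cong< (∣r=-partialSum (∂r F) ℕₚ.≤-refl) (truncate ≋-refl)) ⟨
    ((λ n → D (F n)) ∣r= R) ⊕ ((∂r F ∣r= R) ⊗ D R) ∎
    where
    term : ∀ n → F (suc n) ⊗ D (R ↑ suc n) ≋ (∂r F n ⊗ R ↑ n) ⊗ D R
    term n = begin
      F (suc n) ⊗ D (R ↑ suc n)                 ≈⟨ ⊗-cong ≋-refl (power-rule d R n) ⟩
      F (suc n) ⊗ (s · ((R ↑ n) ⊗ D R))         ≈⟨ ⊗-·-comm s (F (suc n)) ((R ↑ n) ⊗ D R) ⟩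
      s · (F (suc n) ⊗ ((R ↑ n) ⊗ D R))         ≈⟨ ·-⊗-assoc s (F (suc n)) ((R ↑ n) ⊗ D R) ⟨
      (s · F (suc n)) ⊗ ((R ↑ n) ⊗ D R)         ≈⟨ ⊗-assoc (s · F (suc n)) (R ↑ n) (D R) ⟨
      ((s · F (suc n)) ⊗ R ↑ n) ⊗ D R           ∎
      where
      open SetoidReasoning ≋-setoid
      s = fromℕℚ (suc n)

    partial : ∀ N → D (partialSum (suc N) F R) ≋ partialSum (suc N) (D ∘ F) R ⊕ (partialSum N (∂r F) R ⊗ D R)
    partial N = begin
      D (partialSum (suc N) F R)
        ≈⟨ homo-sumPS d (suc N) (λ n → F n ⊗ R ↑ n) ⟩
      sumPS (suc N) (λ n → D (F n ⊗ R ↑ n))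
        ≈⟨ sumPS-cong (suc N) (λ n → leibniz d (F n) (R ↑ n)) ⟩
      sumPS (suc N) (λ n → (D (F n) ⊗ R ↑ n) ⊕ (F n ⊗ D (R ↑ n)))
        ≈⟨ sumPS-⊕ (suc N) (λ n → D (F n) ⊗ R ↑ n) (λ n → F n ⊗ D (R ↑ n)) ⟩
      partialSum (suc N) (D ∘ F) R ⊕ sumPS (suc N) (λ n → F n ⊗ D (R ↑ n))
        ≈⟨ ⊕-cong ≋-refl (mk λ _ → refl) ⟩
      partialSum (suc N) (D ∘ F) R ⊕ (F 0 ⊗ D 𝟏 ⊕ sumPS N (λ n → F (suc n) ⊗ D (R ↑ suc n)))
        ≈⟨ ⊕-cong ≋-refl (⊕-cong (≋-trans (⊗-cong ≋-refl (D-𝟏 d)) (⊗-zeroʳ (F 0))) (sumPS-cong N term)) ⟩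
      partialSum (suc N) (D ∘ F) R ⊕ (𝟎 ⊕ sumPS N (λ n → (∂r F n ⊗ R ↑ n) ⊗ D R))
        ≈⟨ ⊕-cong ≋-refl (≋-trans (mk λ α → trans (cong (_+ coeff S α) (coeff-𝟎 α)) (ℚₚ.+-identityˡ (coeff S α)))
             (≋-sym (sumPS-⊗ N (λ n → ∂r F n ⊗ R ↑ n) (D R)))) ⟩
      partialSum (suc N) (D ∘ F) R ⊕ (partialSum N (∂r F) R ⊗ D R) ∎
      where
      open SetoidReasoning ≋-setoid
      S = sumPS N (λ n → (∂r F n ⊗ R ↑ n) ⊗ D R)

-- Multiplication by 1+r and the operator θ on series in r

[1+r]-cong : ∀ {F G : Series} → (∀ n → F n ≋ G n) → ∀ n → ([1+r]· F) n ≋ ([1+r]· G) n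
[1+r]-cong p zero    = p 0
[1+r]-cong p (suc n) = ⊕-cong (p (suc n)) (p n)

[1+r]-⊕ : ∀ F G n → ([1+r]· (λ m → F m ⊕ G m)) n ≋ ([1+r]· F) n ⊕ ([1+r]· G) n
[1+r]-⊕ F G zero    = ≋-refl
[1+r]-⊕ F G (suc n) = mk λ α → interchange (coeff (F (suc n)) α) (coeff (G (suc n)) α) (coeff (F n) α) (coeff (G n) α)

[1+r]-· : ∀ q F n → ([1+r]· (λ m → q · F m)) n ≋ q · ([1+r]· F) n
[1+r]-· q F zero    = ≋-refl
[1+r]-· q F (suc n) = mk λ α → sym (ℚₚ.*-distribˡ-+ q (coeff (F (suc n)) α) (coeff (F n) α))

-- Statements about division by 1+r are proved after multiplying by 1+r, where `[1+r]-inverse`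
-- applies.
[1+r]-injective : ∀ {F G : Series} → (∀ n → ([1+r]· F) n ≋ ([1+r]· G) n) → ∀ n → F n ≋ G n
[1+r]-injective p zero    = p 0
[1+r]-injective {F} {G} p (suc n) = mk λ α → let open ≡-Reasoning in begin
  coeff (F (suc n)) α
    ≡⟨ solve 2 (λ x y → x := (x :+ y) :- y) refl (coeff (F (suc n)) α) (coeff (F n) α) ⟩
  (coeff (F (suc n)) α + coeff (F n) α) - coeff (F n) α
    ≡⟨ cong₂ _-_ (at (p (suc n)) α) (at ([1+r]-injective p n) α) ⟩
  (coeff (G (suc n)) α + coeff (G n) α) - coeff (G n) α
    ≡⟨ solve 2 (λ x y → x := (x :+ y) :- y) refl (coeff (G (suc n)) α) (coeff (G n) α) ⟨
  coeff (G (suc n)) α ∎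

θ-cong : ∀ {F G : Series} → (∀ n → F n ≋ G n) → ∀ n → θ F n ≋ θ G n
θ-cong p = [1+r]-cong (λ n → ·-cong (fromℕℚ (suc n)) (p (suc n)))

θ-⊕ : ∀ F G n → θ (λ m → F m ⊕ G m) n ≋ θ F n ⊕ θ G n
θ-⊕ F G n = ≋-trans
  ([1+r]-cong (λ m → mk λ α → ℚₚ.*-distribˡ-+ (fromℕℚ (suc m)) (coeff (F (suc m)) α) (coeff (G (suc m)) α)) n)
  ([1+r]-⊕ (∂r F) (∂r G) n)

θ-· : ∀ q F n → θ (λ m → q · F m) n ≋ q · θ F n
θ-· q F n = ≋-trans
  ([1+r]-cong (λ m → mk λ α → solve 3 (λ s q x → s :* (q :* x) := q :* (s :* x)) refl (fromℕℚ (suc m)) q (coeff (F (suc m)) α)) n)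
  ([1+r]-· q (∂r F) n)

θ-[1+r] : ∀ F n → θ ([1+r]· F) n ≋ ([1+r]· θ F) n ⊕ ([1+r]· F) n
θ-[1+r] F n = ≋-trans ([1+r]-cong ∂r-[1+r] n) ([1+r]-⊕ (θ F) F n)
  where
  ∂r-[1+r] : ∀ n → ∂r ([1+r]· F) n ≋ θ F n ⊕ F n
  ∂r-[1+r] zero    = mk λ α → solve 2 (λ x y → con 1ℚ :* (x :+ y) := con 1ℚ :* x :+ y) refl (coeff (F 1) α) (coeff (F 0) α)
  ∂r-[1+r] (suc n) = mk λ α → let s = fromℕℚ (suc n); s′ = fromℕℚ (suc (suc n)); x = coeff (F (suc (suc n))) α; y = coeff (F (suc n)) α in
    trans (ℚₚ.*-distribˡ-+ s′ x y) (trans (cong (λ z → s′ * x + z * y) (fromℕℚ-suc (suc n)))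
      (solve 4 (λ s s′ x y → s′ :* x :+ (con 1ℚ :+ s) :* y := (s′ :* x :+ s :* y) :+ y) refl s s′ x y))

-- Derivations acting on a series in r as s θ + u

module _ {D : PowerSeries → PowerSeries} (d : Derivation D) where

  D-[1+r] : ∀ F n → D (([1+r]· F) n) ≋ ([1+r]· (λ m → D (F m))) n
  D-[1+r] F zero    = ≋-refl
  D-[1+r] F (suc n) = homo-⊕ d (F (suc n)) (F n)

  D-θ : ∀ F n → D (θ F n) ≋ θ (λ m → D (F m)) n
  D-θ F n = ≋-trans (D-[1+r] (∂r F) n) ([1+r]-cong (λ m → homo-· d (fromℕℚ (suc m)) (F (suc m))) n)

  D-𝟎 : D 𝟎 ≋ 𝟎
  D-𝟎 = ≋-trans (D-cong d 𝟎≋0·𝟎) (≋-trans (homo-· d 0ℚ 𝟎) (mk λ α → trans (ℚₚ.*-zeroˡ (coeff (D 𝟎) α)) (sym (coeff-𝟎 α))))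
    where
    𝟎≋0·𝟎 : 𝟎 ≋ 0ℚ · 𝟎
    𝟎≋0·𝟎 = mk λ α → trans (coeff-𝟎 α) (sym (ℚₚ.*-zeroˡ (coeff 𝟎 α)))

  -- D differentiates the coefficients while r counts as a constant. As s and u are numbers, s θ + u
  -- commutes with θ, and the property passes to every P(θ) F with the same s and u.
  record ActsAs (s u : ℚ) (F : Series) : Set where
    constructor acts
    field act : ∀ n → D (F n) ≋ (s · θ F n) ⊕ (u · F n)
  open ActsAs

  applyθ-actsAs : ∀ {s u F} → ActsAs s u F → ∀ P → ActsAs s u (applyθ P F)
  applyθ-actsAs {s} {u} {F} h [] = acts λ n → ≋-trans D-𝟎 (≋-sym (≋-trans
    (⊕-cong (·-cong s (θ𝟎 n)) ≋-refl)
    (mk λ α → trans (cong (λ z → s * z + u * z) (coeff-𝟎 α)) (trans (solve 2 (λ s u → s :* con 0ℚ :+ u :* con 0ℚ := con 0ℚ) refl s u) (sym (coeff-𝟎 α))))))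
    where
    θ𝟎 : ∀ n → θ (λ _ → 𝟎) n ≋ 𝟎
    θ𝟎 n = ≋-trans (θ-cong {λ _ → 𝟎} {λ _ → 0ℚ · 𝟎} (λ _ → mk λ α → trans (coeff-𝟎 α) (sym (ℚₚ.*-zeroˡ (coeff 𝟎 α)))) n)
      (≋-trans (θ-· 0ℚ (λ _ → 𝟎) n) (mk λ α → trans (ℚₚ.*-zeroˡ (coeff (θ (λ _ → 𝟎) n) α)) (sym (coeff-𝟎 α))))
  applyθ-actsAs {s} {u} {F} h (c ∷ P) = acts λ n → let open SetoidReasoning ≋-setoid in begin
    D (c · F n ⊕ θ G n)
      ≈⟨ homo-⊕ d (c · F n) (θ G n) ⟩
    D (c · F n) ⊕ D (θ G n)
      ≈⟨ ⊕-cong (≋-trans (homo-· d c (F n)) (·-cong c (act h n))) (≋-trans (D-θ G n) (θ-cong (act (applyθ-actsAs h P)) n)) ⟩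
    c · (s · θ F n ⊕ u · F n) ⊕ θ (λ m → s · θ G m ⊕ u · G m) n
      ≈⟨ ⊕-cong ≋-refl (≋-trans (θ-⊕ (λ m → s · θ G m) (λ m → u · G m) n) (⊕-cong (θ-· s (θ G) n) (θ-· u G n))) ⟩
    c · (s · θ F n ⊕ u · F n) ⊕ (s · θ (θ G) n ⊕ u · θ G n)
      ≈⟨ mk (λ α → solve 7 (λ c s u a b e g → c :* (s :* a :+ u :* b) :+ (s :* e :+ u :* g) := s :* (c :* a :+ e) :+ u :* (c :* b :+ g)) refl
           c s u (coeff (θ F n) α) (coeff (F n) α) (coeff (θ (θ G) n) α) (coeff (θ G n) α)) ⟩
    s · (c · θ F n ⊕ θ (θ G) n) ⊕ u · (c · F n ⊕ θ G n)
      ≈⟨ ⊕-cong (·-cong s (≋-trans (θ-⊕ (λ m → c · F m) (θ G) n) (⊕-cong (θ-· c F n) ≋-refl))) ≋-refl ⟨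
    s · θ (λ m → c · F m ⊕ θ G m) n ⊕ u · (c · F n ⊕ θ G n) ∎
    where
    G = applyθ P F

  -- (1+r)⁻¹ shifts u by s because (1+r)∂_r (1+r)⁻¹ = (1+r)⁻¹ ((1+r)∂_r - 1).
  [1+r]⁻¹-actsAs : ∀ {s u F} → ActsAs s u F → ActsAs s (u + s) ([1+r]⁻¹· F)
  [1+r]⁻¹-actsAs {s} {u} {F} h = acts ([1+r]-injective λ n → let open SetoidReasoning ≋-setoid in begin
    ([1+r]· (λ m → D (H m))) n
      ≈⟨ D-[1+r] H n ⟨
    D (([1+r]· H) n)
      ≈⟨ D-cong d (inv n) ⟩
    D (F n)
      ≈⟨ act h n ⟩
    s · θ F n ⊕ u · F n
      ≈⟨ ⊕-cong (·-cong s (θ-cong inv n)) (·-cong u (inv n)) ⟨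
    s · θ ([1+r]· H) n ⊕ u · ([1+r]· H) n
      ≈⟨ ⊕-cong (·-cong s (θ-[1+r] H n)) ≋-refl ⟩
    s · (([1+r]· θ H) n ⊕ ([1+r]· H) n) ⊕ u · ([1+r]· H) n
      ≈⟨ mk (λ α → solve 4 (λ s u a b → s :* (a :+ b) :+ u :* b := s :* a :+ (u :+ s) :* b) refl
           s u (coeff (([1+r]· θ H) n) α) (coeff (([1+r]· H) n) α)) ⟩
    s · ([1+r]· θ H) n ⊕ (u + s) · ([1+r]· H) n
      ≈⟨ ⊕-cong ([1+r]-· s (θ H) n) ([1+r]-· (u + s) H n) ⟨
    ([1+r]· (λ m → s · θ H m)) n ⊕ ([1+r]· (λ m → (u + s) · H m)) n
      ≈⟨ [1+r]-⊕ (λ m → s · θ H m) (λ m → (u + s) · H m) n ⟨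
    ([1+r]· (λ m → s · θ H m ⊕ (u + s) · H m)) n ∎)
    where
    H = [1+r]⁻¹· F
    inv : ∀ n → ([1+r]· H) n ≋ F n
    inv n = mk ([1+r]-inverse F n)

  [1+r]^-actsAs : ∀ b {s u F} → ActsAs s u F → ActsAs s (u + fromℕℚ b * s) ([1+r]^- b · F)
  [1+r]^-actsAs zero {s} {u} {F} h = subst (λ z → ActsAs s z F) (solve 2 (λ s u → u := u :+ con 0ℚ :* s) refl s u) h
  [1+r]^-actsAs (suc b) {s} {u} {F} h = subst (λ z → ActsAs s z ([1+r]^- suc b · F)) eq ([1+r]⁻¹-actsAs ([1+r]^-actsAs b h))
    where
    eq : u + fromℕℚ b * s + s ≡ u + fromℕℚ (suc b) * s
    eq = trans (solve 3 (λ b s u → u :+ b :* s :+ s := u :+ (con 1ℚ :+ b) :* s) refl (fromℕℚ b) s u)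
               (cong (λ z → u + z * s) (sym (fromℕℚ-suc b)))

  module _ (R : PowerSeries) (R₀ : coeff R [] ≡ 0ℚ) where
    open Substitution R R₀

    -- The total effect of D on the argument: s (1+R) is the part induced by s θ on the
    -- coefficients, and D R is the part from the substituted series.
    defect : ℚ → PowerSeries
    defect s = s · (𝟏 ⊕ R) ⊕ D R

    -- θ F at r = R is (1+R) F′(R), so the coefficient part merges with the chain-rule term into one
    -- multiple of F′(R), whose other factor is the same for all F.
    D-∣r= : ∀ {s u F} → ActsAs s u F → D (F ∣r= R) ≋ ((∂r F ∣r= R) ⊗ defect s) ⊕ u · (F ∣r= R)
    D-∣r= {s} {u} {F} h = begin
      D (F ∣r= R)
        ≈⟨ chain-rule d F ⟩
      ((λ n → D (F n)) ∣r= R) ⊕ (F′ ⊗ D R)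
        ≈⟨ ⊕-cong (≋-trans (∣r=-cong R (act h)) (≋-trans (∣r=-⊕ R (λ n → s · θ F n) (λ n → u · F n))
             (⊕-cong (∣r=-· R s (θ F)) (∣r=-· R u F)))) ≋-refl ⟩
      (s · (θ F ∣r= R) ⊕ u · (F ∣r= R)) ⊕ (F′ ⊗ D R)
        ≈⟨ ⊕-cong (⊕-cong (≋-trans (·-cong s (∣r=-[1+r]· (∂r F))) (≋-sym (⊗-·-comm s F′ (𝟏 ⊕ R)))) ≋-refl) ≋-refl ⟩
      ((F′ ⊗ (s · (𝟏 ⊕ R))) ⊕ u · (F ∣r= R)) ⊕ (F′ ⊗ D R)
        ≈⟨ mk (λ α → solve 3 (λ a b c → (a :+ b) :+ c := (a :+ c) :+ b) refl
             (coeff (F′ ⊗ (s · (𝟏 ⊕ R))) α) (coeff (u · (F ∣r= R)) α) (coeff (F′ ⊗ D R) α)) ⟩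
      ((F′ ⊗ (s · (𝟏 ⊕ R))) ⊕ (F′ ⊗ D R)) ⊕ u · (F ∣r= R)
        ≈⟨ ⊕-cong (⊗-distribˡ-⊕ F′ (s · (𝟏 ⊕ R)) (D R)) ≋-refl ⟨
      (F′ ⊗ defect s) ⊕ u · (F ∣r= R) ∎
      where
      open SetoidReasoning ≋-setoid
      F′ = ∂r F ∣r= R

    -- Since W(R) = 0 and W′(R) is a unit, D forces D R = -s(1+R), which makes the
    -- transport term vanish for every other series on which D acts the same way.
    D-∣r=-root : ∀ {s u W} → ActsAs s u W → coeff (W 1) [] ≡ 1ℚ → (W ∣r= R) ≋ 𝟎 →
                 ∀ {F} → ActsAs s u F → D (F ∣r= R) ≋ u · (F ∣r= R)
    D-∣r=-root {s} {u} {W} hW W₁ W∣R≋𝟎 {F} hF = begin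
      D (F ∣r= R)                                      ≈⟨ D-∣r= hF ⟩
      ((∂r F ∣r= R) ⊗ defect s) ⊕ u · (F ∣r= R)        ≈⟨ ⊕-cong (≋-trans (⊗-cong ≋-refl defect≋𝟎) (⊗-zeroʳ (∂r F ∣r= R))) ≋-refl ⟩
      𝟎 ⊕ u · (F ∣r= R)                                ≈⟨ mk (λ α → trans (cong (_+ coeff (u · (F ∣r= R)) α) (coeff-𝟎 α)) (ℚₚ.+-identityˡ _)) ⟩
      u · (F ∣r= R)                                    ∎
      where
      open SetoidReasoning ≋-setoid
      W′ = ∂r W ∣r= R
      unit : coeff W′ [] ≡ 1ℚ
      unit = cong (λ z → (1ℚ * z) * 1ℚ + 0ℚ) W₁
      product≋𝟎 : W′ ⊗ defect s ≋ 𝟎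
      product≋𝟎 = begin
        W′ ⊗ defect s
          ≈⟨ mk (λ α → solve 3 (λ x u y → x := (x :+ u :* y) :- u :* y) refl (coeff (W′ ⊗ defect s) α) u (coeff (W ∣r= R) α)) ⟩
        ((W′ ⊗ defect s) ⊕ u · (W ∣r= R)) ⊖ u · (W ∣r= R)
          ≈⟨ mk (λ α → cong₂ (λ x y → x - u * y)
               (trans (sym (at (D-∣r= hW) α)) (trans (at (≋-trans (D-cong d W∣R≋𝟎) D-𝟎) α) (coeff-𝟎 α)))
               (trans (at W∣R≋𝟎 α) (coeff-𝟎 α))) ⟩
        record { coeff = λ _ → 0ℚ - u * 0ℚ ; coeff-pad = λ _ → refl }
          ≈⟨ mk (λ α → trans (solve 1 (λ u → con 0ℚ :- u :* con 0ℚ := con 0ℚ) refl u) (sym (coeff-𝟎 α))) ⟩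
        𝟎 ∎
      defect≋𝟎 : defect s ≋ 𝟎
      defect≋𝟎 = ⊗-cancel-unit W′ (defect s) unit product≋𝟎

-- Each division by 1+r becomes a division by the unit 1+R after substitution, so R remains a root.
[1+r]^-∣r= : ∀ R → coeff R [] ≡ 0ℚ → ∀ b F → (F ∣r= R) ≋ 𝟎 → (([1+r]^- b · F) ∣r= R) ≋ 𝟎
[1+r]^-∣r= R R₀ zero    F p = p
[1+r]^-∣r= R R₀ (suc b) F p = ⊗-cancel-unit (𝟏 ⊕ R) (H ∣r= R) (cong (_+_ 1ℚ) R₀) (begin
  (𝟏 ⊕ R) ⊗ (H ∣r= R)   ≈⟨ ⊗-comm (𝟏 ⊕ R) (H ∣r= R) ⟩
  (H ∣r= R) ⊗ (𝟏 ⊕ R)   ≈⟨ Substitution.∣r=-[1+r]· R R₀ H ⟨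
  ([1+r]· H) ∣r= R       ≈⟨ ∣r=-cong R {[1+r]· H} {G} (λ n → mk ([1+r]-inverse G n)) ⟩
  G ∣r= R                ≈⟨ [1+r]^-∣r= R R₀ b F p ⟩
  𝟎                      ∎)
  where
  open SetoidReasoning ≋-setoid
  G = [1+r]^- b · F
  H = [1+r]⁻¹· G

[1+r]^-coeff₀ : ∀ b F → coeff (F 0) [] ≡ 0ℚ → coeff (([1+r]^- b · F) 0) [] ≡ 0ℚ
[1+r]^-coeff₀ zero    F F₀ = F₀
[1+r]^-coeff₀ (suc b) F F₀ = [1+r]^-coeff₀ b F F₀

-- Division by 1+r subtracts the r^0 coefficient from the r^1 coefficient, and the former has
-- constant term 0. This is what makes W′(R) invertible.
[1+r]^-coeff₁ : ∀ b F → coeff (F 0) [] ≡ 0ℚ → coeff (F 1) [] ≡ 1ℚ → coeff (([1+r]^- b · F) 1) [] ≡ 1ℚ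
[1+r]^-coeff₁ zero    F F₀ F₁ = F₁
[1+r]^-coeff₁ (suc b) F F₀ F₁ = cong₂ _-_ ([1+r]^-coeff₁ b F F₀ F₁) ([1+r]^-coeff₀ b F F₀)

-- Series that are affine in the variables

const-+ : ∀ p q → const p ⊕ const q ≋ const (p + q)
const-+ p q = mk go
  where
  go : ∀ α → coeff (const p) α + coeff (const q) α ≡ coeff (const (p + q)) α
  go []          = refl
  go (zero  ∷ α) = go α
  go (suc _ ∷ α) = refl

const-* : ∀ p q → p · const q ≋ const (p * q)
const-* p q = mk go
  where
  go : ∀ α → p * coeff (const q) α ≡ coeff (const (p * q)) α
  go []          = refl
  go (zero  ∷ α) = go α
  go (suc _ ∷ α) = ℚₚ.*-zeroʳ p

const-cong : ∀ {p q} → p ≡ q → const p ≋ const q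
const-cong refl = ≋-refl

const-neg : ∀ q → neg (const q) ≋ const (- q)
const-neg q = ≋-trans (≋-sym (neg-≋ (const q))) (≋-trans (const-* (- 1ℚ) q)
  (const-cong (solve 1 (λ x → con (- 1ℚ) :* x := :- x) refl q)))

const-∑ : ∀ n c → sumPS n (λ i → const (c i)) ≋ const (∑< n c)
const-∑ zero    c = mk λ α → sym (coeff-𝟎 α)
const-∑ (suc n) c = ≋-trans (mk λ _ → refl) (≋-trans (⊕-cong ≋-refl (const-∑ n (c ∘ suc))) (const-+ (c 0) (∑< n (c ∘ suc))))

neg-cong : ∀ {f g} → f ≋ g → neg f ≋ neg g
neg-cong p = mk λ α → cong -_ (at p α)

-- The sign matches `Ž`, whose coefficients have this shape by definition. Identities between such
-- series reduce to identities of rationals, one for A and one for each B ℓ.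
affine : ℚ → (ℕ → ℚ) → PowerSeries
affine A B = const A ⊖ ∑x (λ ℓ → const (B ℓ))

affine-cong : ∀ {A A′ B B′} → A ≡ A′ → (∀ ℓ → B ℓ ≡ B′ ℓ) → affine A B ≋ affine A′ B′
affine-cong p q = ⊕-cong (const-cong p) (neg-cong (∑x-cong (λ ℓ → const-cong (q ℓ))))

affine-⊕ : ∀ A A′ B B′ → affine A B ⊕ affine A′ B′ ≋ affine (A + A′) (λ ℓ → B ℓ + B′ ℓ)
affine-⊕ A A′ B B′ = ≋-trans
  (mk λ α → solve 4 (λ a b c d → (a :- b) :+ (c :- d) := (a :+ c) :- (b :+ d)) refl
     (coeff (const A) α) (coeff (∑x (const ∘ B)) α) (coeff (const A′) α) (coeff (∑x (const ∘ B′)) α))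
  (⊕-cong (const-+ A A′) (neg-cong (≋-trans (≋-sym (∑x-⊕ (const ∘ B) (const ∘ B′))) (∑x-cong (λ ℓ → const-+ (B ℓ) (B′ ℓ))))))

affine-· : ∀ q A B → q · affine A B ≋ affine (q * A) (λ ℓ → q * B ℓ)
affine-· q A B = ≋-trans
  (mk λ α → solve 3 (λ q a b → q :* (a :- b) := q :* a :- q :* b) refl q (coeff (const A) α) (coeff (∑x (const ∘ B)) α))
  (⊕-cong (const-* q A) (neg-cong (≋-trans (≋-sym (∑x-· q (const ∘ B))) (∑x-cong (λ ℓ → const-* q (B ℓ))))))

const-raise : ∀ q k α → coeff (const q) (raise k α) ≡ 0ℚ
const-raise q zero    []          = refl
const-raise q (suc k) []          = const-raise q k []
const-raise q zero    (a ∷ α)     = refl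
const-raise q (suc k) (zero ∷ α)  = const-raise q k α
const-raise q (suc k) (suc a ∷ α) = refl

∑x-const-zero : ∀ h α → coeff (∑x (const ∘ h)) (0 ∷ α) ≡ coeff (∑x (const ∘ h ∘ suc)) α
∑x-const-zero h α = trans (ℚₚ.+-identityˡ _) (∑<-cong (length α) (λ ℓ → maybe-map (coeff (const (h (suc ℓ)))) 0 (lower ℓ α)))

-- For ℓ > 0 the quotient by x̂_ℓ is still divisible by x̂_0, where a constant has coefficient 0.
∑x-const-suc : ∀ h a α → coeff (∑x (const ∘ h)) (suc a ∷ α) ≡ coeff (const (h 0)) (a ∷ α)
∑x-const-suc h a α = trans
  (cong (_+_ (coeff (const (h 0)) (a ∷ α))) (trans (∑<-cong (length α) vanish) (∑<-zero (length α))))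
  (ℚₚ.+-identityʳ _)
  where
  vanish : ∀ ℓ → maybe′ (coeff (const (h (suc ℓ)))) 0ℚ (mapᴹ (suc a ∷_) (lower ℓ α)) ≡ 0ℚ
  vanish ℓ with lower ℓ α
  ... | just _  = refl
  ... | nothing = refl

∂-∑x-const : ∀ k h → ∂ k (∑x (const ∘ h)) ≋ const (h k)
∂-∑x-const k h = mk (go k h)
  where
  go : ∀ k h α → ∂ᶜ k (coeff (∑x (const ∘ h))) α ≡ coeff (const (h k)) α
  go zero h []          = solve 1 (λ x → con 1ℚ :* (x :+ con 0ℚ) := x) refl (h 0)
  go zero h (zero ∷ α)  = trans (cong (1ℚ *_) (∑x-const-suc h 0 α)) (ℚₚ.*-identityˡ (coeff (const (h 0)) α))
  go zero h (suc a ∷ α) = trans (cong (fromℕℚ (suc (suc a)) *_) (∑x-const-suc h (suc a) α)) (ℚₚ.*-zeroʳ (fromℕℚ (suc (suc a))))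
  go (suc k) h []          = trans (cong (1ℚ *_) (∑x-const-zero h (raise k []))) (go k (h ∘ suc) [])
  go (suc k) h (zero ∷ α)  = trans (cong (fromℕℚ (suc (exponent k α)) *_) (∑x-const-zero h (raise k α))) (go k (h ∘ suc) α)
  go (suc k) h (suc a ∷ α) = trans
    (cong (fromℕℚ (suc (exponent k α)) *_) (trans (∑x-const-suc h a (raise k α)) (const-raise (h 0) (suc k) (a ∷ α))))
    (ℚₚ.*-zeroʳ (fromℕℚ (suc (exponent k α))))

∂-const : ∀ k q → ∂ k (const q) ≋ 𝟎
∂-const k q = mk λ α → trans (cong (fromℕℚ (suc (exponent k α)) *_) (const-raise q k α))
  (trans (ℚₚ.*-zeroʳ (fromℕℚ (suc (exponent k α)))) (sym (coeff-𝟎 α)))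

∂-affine : ∀ k A B → ∂ k (affine A B) ≋ const (- B k)
∂-affine k A B = begin
  ∂ k (affine A B)
    ≈⟨ mk (λ α → solve 3 (λ e a b → e :* (a :- b) := e :* a :- e :* b) refl
         (fromℕℚ (suc (exponent k α))) (coeff (const A) (raise k α)) (coeff (∑x (const ∘ B)) (raise k α))) ⟩
  ∂ k (const A) ⊖ ∂ k (∑x (const ∘ B))
    ≈⟨ ⊕-cong (∂-const k A) (≋-trans (neg-cong (∂-∑x-const k B)) (const-neg (B k))) ⟩
  𝟎 ⊕ const (- B k)
    ≈⟨ mk (λ α → trans (cong (_+ coeff (const (- B k)) α) (coeff-𝟎 α)) (ℚₚ.+-identityˡ _)) ⟩
  const (- B k) ∎
  where open SetoidReasoning ≋-setoid

-- The action of D^str and D^dil on Ž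

θŽ : ∀ b p → θ (Ž b) p ≋ affine (θℚ (J b) p) (λ ℓ → θℚ (I b ℓ) p)
-- At r^0 multiplication by 1+r adds no lower term, whereas `θℚ` carries the summand 0 · F 0; `pad`
-- inserts it.
θŽ b zero    = ≋-trans (affine-· 1ℚ (J b 1) (λ ℓ → I b ℓ 1))
  (affine-cong (pad (J b 1) (J b 0)) (λ ℓ → pad (I b ℓ 1) (I b ℓ 0)))
  where
  pad : ∀ x y → 1ℚ * x ≡ 1ℚ * x + 0ℚ * y
  pad = solve 2 (λ x y → con 1ℚ :* x := con 1ℚ :* x :+ con 0ℚ :* y) refl
θŽ b (suc p) = ≋-trans (⊕-cong (affine-· s′ (J b (suc (suc p))) (λ ℓ → I b ℓ (suc (suc p)))) (affine-· s (J b (suc p)) (λ ℓ → I b ℓ (suc p))))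
  (affine-⊕ (s′ * J b (suc (suc p))) (s * J b (suc p)) (λ ℓ → s′ * I b ℓ (suc (suc p))) (λ ℓ → s * I b ℓ (suc p)))
  where
  s  = fromℕℚ (suc p)
  s′ = fromℕℚ (suc (suc p))

θŽ-combination : ∀ s u b p → s · θ (Ž b) p ⊕ u · Ž b p ≋
                 affine (s * θℚ (J b) p + u * J b p) (λ ℓ → s * θℚ (I b ℓ) p + u * I b ℓ p)
θŽ-combination s u b p = ≋-trans
  (⊕-cong (≋-trans (·-cong s (θŽ b p)) (affine-· s (θℚ (J b) p) (λ ℓ → θℚ (I b ℓ) p))) (affine-· u (J b p) (λ ℓ → I b ℓ p)))
  (affine-⊕ (s * θℚ (J b) p) (u * J b p) (λ ℓ → s * θℚ (I b ℓ) p) (λ ℓ → u * I b ℓ p))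

-- Every first derivative of `Ž` is a constant - I(k), so the image is again affine: its constant
-- part is settled by `θJ`, and its coefficient of x̂_ℓ by `θI`.
Dˢᵗʳ-Ž : ∀ b p → Dˢᵗʳ b (Ž b p) ≋ - 1ℚ · θ (Ž b) p ⊕ fromℕℚ b · Ž b p
Dˢᵗʳ-Ž b p = begin
  Dˢᵗʳ b (Ž b p)
    ≈⟨ ⊕-cong (∂Ž 1) (neg-cong (∑x-cong coefficient)) ⟩
  affine (- i 1) (λ ℓ → - (fromℕℚ ℓ * - i ℓ) + S′ ℓ - S′ b)
    ≈⟨ affine-cong eqJ eqI ⟩
  affine (- 1ℚ * θℚ (J b) p + β * J b p) (λ ℓ → - 1ℚ * θℚ (I b ℓ) p + β * i ℓ)
    ≈⟨ θŽ-combination (- 1ℚ) β b p ⟨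
  - 1ℚ · θ (Ž b) p ⊕ β · Ž b p ∎
  where
  open SetoidReasoning ≋-setoid
  β = fromℕℚ b
  i S S′ : ℕ → ℚ
  i ℓ = I b ℓ p
  S  n = ∑< n (λ k → fromℕℚ (2 ℕ.* suc k) * i (suc k))
  S′ n = ∑< n (λ k → fromℕℚ (2 ℕ.* suc k) * - i (suc k))

  ∂Ž : ∀ k → ∂ k (Ž b p) ≋ const (- i k)
  ∂Ž k = ∂-affine k (J b p) i

  ∑2k∂-Ž : ∀ n → ∑2k∂ n (Ž b p) ≋ const (S′ n)
  ∑2k∂-Ž n = ≋-trans (sumPS-cong n (λ k → ≋-trans (·-cong (fromℕℚ (2 ℕ.* suc k)) (∂Ž (suc k))) (const-* (fromℕℚ (2 ℕ.* suc k)) (- i (suc k)))))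
                     (const-∑ n (λ k → fromℕℚ (2 ℕ.* suc k) * - i (suc k)))

  coefficient : ∀ ℓ → neg (fromℕℚ ℓ · ∂ ℓ (Ž b p)) ⊕ ∑2k∂ ℓ (Ž b p) ⊖ ∑2k∂ b (Ž b p)
                      ≋ const (- (fromℕℚ ℓ * - i ℓ) + S′ ℓ - S′ b)
  coefficient ℓ = ≋-trans
    (⊕-cong (≋-trans (⊕-cong (≋-trans (neg-cong (≋-trans (·-cong (fromℕℚ ℓ) (∂Ž ℓ)) (const-* (fromℕℚ ℓ) (- i ℓ)))) (const-neg (fromℕℚ ℓ * - i ℓ)))
                             (∑2k∂-Ž ℓ))
                     (const-+ (- (fromℕℚ ℓ * - i ℓ)) (S′ ℓ)))
            (≋-trans (neg-cong (∑2k∂-Ž b)) (const-neg (S′ b))))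
    (const-+ (- (fromℕℚ ℓ * - i ℓ) + S′ ℓ) (- S′ b))

  S′≡-S : ∀ n → S′ n ≡ - 1ℚ * S n
  S′≡-S n = trans (∑<-cong n (λ k → solve 2 (λ x y → x :* (:- y) := con (- 1ℚ) :* (x :* y)) refl (fromℕℚ (2 ℕ.* suc k)) (i (suc k))))
                  (∑<-* n (- 1ℚ) (λ k → fromℕℚ (2 ℕ.* suc k) * i (suc k)))

  eqJ : - i 1 ≡ - 1ℚ * θℚ (J b) p + β * J b p
  eqJ = trans (cong -_ (sym (θJ b p)))
    (solve 3 (λ t β j → :- (t :- β :* j) := con (- 1ℚ) :* t :+ β :* j) refl (θℚ (J b) p) β (J b p))

  eqI : ∀ ℓ → - (fromℕℚ ℓ * - i ℓ) + S′ ℓ - S′ b ≡ - 1ℚ * θℚ (I b ℓ) p + β * i ℓ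
  eqI ℓ = trans (cong₂ (λ x y → - (fromℕℚ ℓ * - i ℓ) + x - y) (S′≡-S ℓ) (S′≡-S b))
    (trans (solve 4 (λ l i x y → :- (l :* (:- i)) :+ con (- 1ℚ) :* x :- con (- 1ℚ) :* y := :- ((:- (l :* i) :+ x) :- y)) refl (fromℕℚ ℓ) (i ℓ) (S ℓ) (S b))
    (trans (cong -_ (sym (θI b ℓ p)))
    (solve 3 (λ t β j → :- (t :- β :* j) := con (- 1ℚ) :* t :+ β :* j) refl (θℚ (I b ℓ) p) β (i ℓ))))

-- The Euler sum reproduces the linear part up to sign, and the two extra derivatives contribute
-- I(0) - I(1) = -J to the constant part.
Dᵈⁱˡ-Ž : ∀ b p → Dᵈⁱˡ (Ž b p) ≋ 0ℚ · θ (Ž b) p ⊕ - 1ℚ · Ž b p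
Dᵈⁱˡ-Ž b p = begin
  Dᵈⁱˡ (Ž b p)
    ≈⟨ ⊕-cong (≋-trans (⊕-cong (∂Ž 1) (≋-trans (neg-cong (∂Ž 0)) (const-neg (- i 0)))) (const-+ (- i 1) (- - i 0))) (neg-cong (∑x-cong ∂Ž)) ⟩
  affine (- i 1 - - i 0) (λ ℓ → - i ℓ)
    ≈⟨ affine-cong eqJ (λ ℓ → solve 2 (λ t i → :- i := con 0ℚ :* t :+ con (- 1ℚ) :* i) refl (θℚ (I b ℓ) p) (i ℓ)) ⟩
  affine (0ℚ * θℚ (J b) p + - 1ℚ * J b p) (λ ℓ → 0ℚ * θℚ (I b ℓ) p + - 1ℚ * i ℓ)
    ≈⟨ θŽ-combination 0ℚ (- 1ℚ) b p ⟨
  0ℚ · θ (Ž b) p ⊕ - 1ℚ · Ž b p ∎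
  where
  open SetoidReasoning ≋-setoid
  i : ℕ → ℚ
  i ℓ = I b ℓ p
  ∂Ž : ∀ k → ∂ k (Ž b p) ≋ const (- i k)
  ∂Ž k = ∂-affine k (J b p) i
  eqJ : - i 1 - - i 0 ≡ 0ℚ * θℚ (J b) p + - 1ℚ * J b p
  eqJ = trans (solve 3 (λ t x y → :- x :- (:- y) := con 0ℚ :* t :+ con (- 1ℚ) :* (x :- y)) refl (θℚ (J b) p) (i 1) (i 0))
              (cong (λ z → 0ℚ * θℚ (J b) p + - 1ℚ * z) (sym (J≡I₁-I₀ b p)))

D-M̌ : ∀ {D} (d : Derivation D) s u b → ActsAs d s u (Ž b) → ∀ Q R → IsŘ b R →
      D (M̌ Q b R) ≋ (u + fromℕℚ b * s) · M̌ Q b R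
D-M̌ d s u b h Q R (R₀ , Ž∣R≈0) = D-∣r=-root d R R₀ hW
  -- The two `refl` are computations: the constant terms of the r^0 and r^1 coefficients of `Ž` are
  -- 0 and 1 for every b.
  ([1+r]^-coeff₁ b (Ž b) refl refl) ([1+r]^-∣r= R R₀ b (Ž b) (mk Ž∣R≈0))
  (applyθ-actsAs d hW (specialise Q b))
  where
  hW : ActsAs d s (u + fromℕℚ b * s) ([1+r]^- b · Ž b)
  hW = [1+r]^-actsAs d b h

lemma20 : (p b : ℕ) (Q : Poly₂) → IsQ p Q → (R : PowerSeries) → IsŘ b R → (Dˢᵗʳ b (M̌ Q b R) ≈ const 0ℚ) × (Dᵈⁱˡ (M̌ Q b R) ≈ neg (M̌ Q b R))
lemma20 p b Q isQ R isŘ = str , dil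
  where
  str : Dˢᵗʳ b (M̌ Q b R) ≈ const 0ℚ
  -- Here u + b s = b - b, so the prefactor (1+r)^(-b) cancels exactly the b left over from θ - b.
  str α = trans (at (D-M̌ (Dˢᵗʳ-derivation b) (- 1ℚ) (fromℕℚ b) b (acts (Dˢᵗʳ-Ž b)) Q R isŘ) α)
    (trans (solve 2 (λ β m → (β :+ β :* con (- 1ℚ)) :* m := con 0ℚ) refl (fromℕℚ b) (coeff (M̌ Q b R) α)) (sym (coeff-𝟎 α)))
  dil : Dᵈⁱˡ (M̌ Q b R) ≈ neg (M̌ Q b R)
  dil α = trans (at (D-M̌ Dᵈⁱˡ-derivation 0ℚ (- 1ℚ) b (acts (Dᵈⁱˡ-Ž b)) Q R isŘ) α)
    (solve 2 (λ β m → (con (- 1ℚ) :+ β :* con 0ℚ) :* m := :- m) refl (fromℕℚ b) (coeff (M̌ Q b R) α))
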